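{- Let $G$ be a block graph. Then $o(G)=\mathcal{D}$ if and only if $G$ admits a perfect $[1,2]$-factor.
   Context: All graphs are finite and simple. A $2$-connected graph is a connected graph that remains connected after the removal of any vertex; a $2$-connected component of a graph is a maximal $2$-connected subgraph of it. A block graph is a graph in which every $2$-connected component is a clique. A perfect $[1,2]$-factor of a graph $G$ is a spanning subgraph of $G$ (a subgraph with the same vertex set) each of whose connected components is either a single edge $K_2$ or a cycle $C_n$, $n\ge 3$. The Maker-Breaker domination game on a graph $G$: two players, Dominator and Staller, alternately claim a not-yet-claimed vertex of $G$. Dominator wins if at some point the vertices she has claimed form a dominating set of $G$. Otherwise, i.e. if Staller manages to claim a vertex and all its neighbors, Staller wins. The graph $G$ has outcome $\mathcal{D}$, written $o(G)=\mathcal{D}$, if Dominator has a winning strategy whoever starts (equivalently, if Dominator has a winning strategy when playing second, since no player benefits from skipping a turn). -}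

module Defs where

open import Data.Fin using (Fin; toℕ; _≟_)
open import Data.Fin.Properties using (toℕ<n; toℕ-fromℕ<)
open import Data.Fin.Subset using (Subset; _∈_; _∉_; _⊆_; _∪_; _-_; ⁅_⁆; ⊤; ⊥; Nonempty)
open import Data.Fin.Subset.Properties using (∈⊤; x∈p∧x≢y⇒x∈p-y)
open import Data.Nat using (ℕ; suc; pred; _+_; _<_; _%_)
open import Data.Nat.DivMod using (_mod_; m%n<n; m<n⇒m%n≡m; n%n≡0)
open import Data.Nat.Properties using (m≤n⇒m<n∨m≡n; 1+n≢n)
open import Data.Product using (∃; ∃-syntax; _×_; _,_; proj₁)
open import Data.Sum using (_⊎_; inj₁; inj₂; swap)
open import Function using (_⇔_; _↔_; Inverse)
open import Level using (0ℓ)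
open import Relation.Binary using (Rel; Decidable; Symmetric; Irreflexive)
open import Relation.Binary.Construct.Closure.ReflexiveTransitive using (Star)
open import Relation.Binary.PropositionalEquality
  using (_≡_; _≢_; refl; sym; trans; cong; ≢-sym)
open import Relation.Nullary using (¬?)
open import Relation.Nullary.Decidable using (_×-dec_; _⊎-dec_)

private
  variable
    m n : ℕ

-- A finite simple graph whose vertex set V is a subset of Fin n. Since V need
-- not be all of Fin n, a subgraph of G is itself a Graph n (see _⊑_).

record Graph (n : ℕ) : Set₁ where
  field
    V        : Subset n
    _~_      : Rel (Fin n) 0ℓ
    _~?_     : Decidable _~_
    ~-sym    : Symmetric _~_
    ~-irrefl : Irreflexive _≡_ _~_
    ~⇒∈V     : ∀ {u v} → u ~ v → u ∈ V

open Graph public using (V)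

Adj : Graph n → Rel (Fin n) 0ℓ
Adj = Graph._~_

Vertex : Graph n → Set
Vertex G = ∃[ v ] v ∈ V G

infix 4 _⊑_ _≅_

_⊑_ : Graph n → Graph n → Set
H ⊑ G = V H ⊆ V G × (∀ {u v} → Adj H u v → Adj G u v)

record _≅_ (G : Graph m) (H : Graph n) : Set where
  field
    bijection : Vertex G ↔ Vertex H
  open Inverse bijection using (to)
  field
    preserves : ∀ u v → Adj G (proj₁ u) (proj₁ v) ⇔ Adj H (proj₁ (to u)) (proj₁ (to v))

delete : Graph n → Fin n → Graph n
delete G w = record
  { V        = V G - w
  ; _~_      = λ u v → u ~ v × u ≢ w × v ≢ w
  ; _~?_     = λ u v → (u ~? v) ×-dec ¬? (u ≟ w) ×-dec ¬? (v ≟ w)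
  ; ~-sym    = λ (u~v , u≢w , v≢w) → ~-sym u~v , v≢w , u≢w
  ; ~-irrefl = λ u≡v (u~v , _) → ~-irrefl u≡v u~v
  ; ~⇒∈V     = λ (u~v , u≢w , _) → x∈p∧x≢y⇒x∈p-y (~⇒∈V u~v) u≢w
  } where open Graph G hiding (V)

-- The graph without vertices is not connected. Hence a single vertex is not
-- 2-connected, but K₂ is.

Connected : Graph n → Set
Connected G = Nonempty (V G) × (∀ {u v} → u ∈ V G → v ∈ V G → Star (Adj G) u v)

2-Connected : Graph n → Set
2-Connected G = Connected G × (∀ {w} → w ∈ V G → Connected (delete G w))

-- H is a maximal subgraph of G with property P.

MaximalSubgraph : (Graph n → Set) → Graph n → Graph n → Set₁
MaximalSubgraph P G H =
  H ⊑ G × P H × (∀ K → K ⊑ G → P K → H ⊑ K → K ⊑ H)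

Component : Graph n → Graph n → Set₁
Component = MaximalSubgraph Connected

2-ConnectedComponent : Graph n → Graph n → Set₁
2-ConnectedComponent = MaximalSubgraph 2-Connected

IsClique : Graph n → Set
IsClique H = ∀ {u v} → u ∈ V H → v ∈ V H → u ≢ v → Adj H u v

IsBlockGraph : Graph n → Set₁
IsBlockGraph G = ∀ H → 2-ConnectedComponent G H → IsClique H

K : ∀ n → Graph n
K n = record
  { V        = ⊤
  ; _~_      = _≢_
  ; _~?_     = λ u v → ¬? (u ≟ v)
  ; ~-sym    = ≢-sym
  ; ~-irrefl = λ u≡v u≢v → u≢v u≡v
  ; ~⇒∈V     = λ _ → ∈⊤
  }

next : Fin (suc n) → Fin (suc n)
next {n} i = suc (toℕ i) mod suc n

next-≢ : (i : Fin (2 + n)) → i ≢ next i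
next-≢ {n} i i≡next = go (m≤n⇒m<n∨m≡n (toℕ<n i))
  where
  i≡suc% : toℕ i ≡ suc (toℕ i) % (2 + n)
  i≡suc% = trans (cong toℕ i≡next) (toℕ-fromℕ< (m%n<n (suc (toℕ i)) (2 + n)))

  go : suc (toℕ i) < 2 + n ⊎ suc (toℕ i) ≡ 2 + n → _
  go (inj₁ lt) = 1+n≢n (sym (trans i≡suc% (m<n⇒m%n≡m lt)))
  go (inj₂ eq) with trans (sym (trans i≡suc% (trans (cong (_% (2 + n)) eq) (n%n≡0 (2 + n)))))
                          (cong pred eq)
  ... | ()

-- The offset makes this the cycle on k + 3 vertices, so that k ranges over all
-- of ℕ as the length ranges over all integers ≥ 3.

C[3+_] : ∀ k → Graph (3 + k)
C[3+ k ] = record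
  { V        = ⊤
  ; _~_      = λ i j → j ≡ next i ⊎ i ≡ next j
  ; _~?_     = λ i j → (j ≟ next i) ⊎-dec (i ≟ next j)
  ; ~-sym    = swap
  ; ~-irrefl = λ { {i} refl (inj₁ e) → next-≢ i e ; {i} refl (inj₂ e) → next-≢ i e }
  ; ~⇒∈V     = λ _ → ∈⊤
  }

IsPerfect[1,2]-Factor : Graph n → Graph n → Set₁
IsPerfect[1,2]-Factor G F =
  F ⊑ G × V F ≡ V G × (∀ H → Component F H → H ≅ K 2 ⊎ ∃[ k ] H ≅ C[3+ k ])

HasPerfect[1,2]-Factor : Graph n → Set₁
HasPerfect[1,2]-Factor G = ∃[ F ] IsPerfect[1,2]-Factor G F

Dominating : Graph n → Subset n → Set
Dominating G D = ∀ {v} → v ∈ V G → v ∈ D ⊎ ∃[ u ] (u ∈ D × Adj G u v)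

data Player : Set where
  dominator staller : Player

Unclaimed : Graph n → Subset n → Subset n → Fin n → Set
Unclaimed G D S v = v ∈ V G × v ∉ D × v ∉ S

-- DominatorWins G p D S is the type of winning strategies (as finite game
-- trees) for Dominator from the position in which Dominator has claimed D,
-- Staller has claimed S, and p is to move. The existence of an unclaimed vertex
-- in `answer` is essential: if no move is left and D is not dominating, then
-- Dominator has lost.

data DominatorWins (G : Graph n) : Player → Subset n → Subset n → Set where
  won    : ∀ {p D S} → Dominating G D → DominatorWins G p D S
  move   : ∀ {D S} v → Unclaimed G D S v →
           DominatorWins G staller (D ∪ ⁅ v ⁆) S →
           DominatorWins G dominator D S
  answer : ∀ {D S} → ∃ (Unclaimed G D S) →
           (∀ v → Unclaimed G D S v → DominatorWins G dominator D (S ∪ ⁅ v ⁆)) →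
           DominatorWins G staller D S

Outcome-𝓓 : Graph n → Set
Outcome-𝓓 G = ∀ firstPlayer → DominatorWins G firstPlayer ⊥ ⊥

{-# OPTIONS --safe #-}
module Submission where

-- A perfect [1,2]-factor of G is the same thing as a permutation of V G that
-- sends every vertex to a neighbour: its orbits are the edges and the cycles of
-- the factor. With such a permutation, Dominator answers each move of Staller
-- by the next vertex of the orbit, or by the previous one if Staller holds the
-- next one already. So every vertex of Staller gets a neighbour of Dominator.
--
-- If there is no such permutation, Hall's theorem yields a set A ⊆ V G with
-- ∣ N A ∣ < ∣ A ∣, and the vertices of A without a neighbour in A form an
-- independent set I with ∣ N I ∣ < ∣ I ∣. Put T = N I. In a block graph the
-- bipartite graph between I and T has no cycle, since the vertices of a cycle
-- lie in one block, which is a clique. Hence there is a leaf. If it is i ∈ I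
-- with neighbour t, then Staller claims t and Dominator has to answer i; if it
-- is t ∈ T with neighbour i, then t and i are dropped. Both keep ∣ T ∣ < ∣ I ∣,
-- until some i ∈ I has no neighbour left in T, and Staller wins by claiming i.

open import Defs
open import Data.Empty using (⊥-elim) renaming (⊥ to Absurd)
open import Data.Fin using (Fin; zero; suc; _≟_; toℕ; fromℕ; inject₁)
open import Data.Fin.Properties
  using (any?; all?; pigeonhole; toℕ-injective; toℕ-fromℕ; toℕ-inject₁; toℕ-fromℕ<; toℕ<n)
open import Data.Fin.Subset
  using (Subset; inside; outside; _∈_; _∉_; _⊆_; _∪_; _∩_; _─_; _-_; ⁅_⁆; ⊤; ⊥; Nonempty; ∣_∣)
open import Data.Fin.Subset.Properties
open import Data.List using (List; []; _∷_; allFin)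
open import Data.List.Membership.Propositional using () renaming (_∈_ to _∈ˡ_)
open import Data.List.Membership.Propositional.Properties using (∈-allFin)
open import Data.List.Relation.Unary.Any using (here; there)
open import Data.Nat using (ℕ; zero; suc; _+_; _≤_; _<_; _%_; z≤n; s≤s; s≤s⁻¹; _≤?_)
open import Data.Nat.DivMod using (m%n<n; m<n⇒m%n≡m; n%n≡0)
open import Data.Nat.Properties as ℕₚ using (≤-trans; ≤-refl; <-≤-trans; ≤-<-trans; ≰⇒>)
open import Data.Product using (∃; ∃-syntax; _×_; _,_; proj₁; proj₂)
open import Data.Sum using (_⊎_; inj₁; inj₂; [_,_]′; swap)
open import Data.Vec using ([]; _∷_; tabulate; here; there)
open import Data.Vec.Properties using ([]=⇒lookup; lookup⇒[]=; lookup∘tabulate)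
open import Data.Vec.Properties.WithK using ([]=-irrelevant)
open import Function using (_∘_; _⇔_; Equivalence; Inverse; mk⇔; mk↔ₛ′)
open import Level using (0ℓ)
open import Relation.Binary using (Rel; Symmetric; tri<; tri≈; tri>)
open import Relation.Binary.Construct.Closure.ReflexiveTransitive as Star using (Star; ε; _◅_; _◅◅_)
open import Relation.Binary.PropositionalEquality hiding (J; [_])
open import Relation.Nullary using (¬_; Dec; yes; no; does; contradiction)
open import Relation.Nullary.Decidable
  using (_×-dec_; _⊎-dec_; _→-dec_; ¬?; dec-true; decidable-stable)
open import Relation.Unary using (Decidable)

private
  variable
    m n : ℕ

-- Finite subsets

subset : {P : Fin n → Set} → Decidable P → Subset n
subset P? = tabulate (does ∘ P?)

module _ {P : Fin n → Set} (P? : Decidable P) where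

  ∈-subset⁺ : ∀ {x} → P x → x ∈ subset P?
  ∈-subset⁺ {x} px =
    lookup⇒[]= x _ (trans (lookup∘tabulate (does ∘ P?) x) (dec-true (P? x) px))

  ∈-subset⁻ : ∀ {x} → x ∈ subset P? → P x
  ∈-subset⁻ {x} x∈ with P? x | trans (sym (lookup∘tabulate (does ∘ P?) x)) ([]=⇒lookup x∈)
  ... | yes px | _ = px
  ... | no _   | ()

x∈p─q⇒x∉q : ∀ (p q : Subset n) {x} → x ∈ p ─ q → x ∉ q
x∈p─q⇒x∉q (_ ∷ _) (outside ∷ _) here       ()
x∈p─q⇒x∉q (_ ∷ p) (outside ∷ q) (there x∈) (there x∈q) = x∈p─q⇒x∉q p q x∈ x∈q
x∈p─q⇒x∉q (_ ∷ p) (inside ∷ q)  (there x∈) (there x∈q) = x∈p─q⇒x∉q p q x∈ x∈q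

x∈p-y⇒x∈p : ∀ {p : Subset n} {x y} → x ∈ p - y → x ∈ p
x∈p-y⇒x∈p {p = p} {y = y} = p─q⊆p p ⁅ y ⁆

x∈p-y⇒x≢y : ∀ {p : Subset n} {x y} → x ∈ p - y → x ≢ y
x∈p-y⇒x≢y {p = p} {x} x∈ refl = x∈p─q⇒x∉q p ⁅ x ⁆ x∈ (x∈⁅x⁆ x)

x∈p∪⁅y⁆⁻ : ∀ {p : Subset n} {x y} → x ∈ p ∪ ⁅ y ⁆ → x ∈ p ⊎ x ≡ y
x∈p∪⁅y⁆⁻ {p = p} {y = y} x∈ with x∈p∪q⁻ p ⁅ y ⁆ x∈
... | inj₁ x∈p = inj₁ x∈p
... | inj₂ x∈y = inj₂ (x∈⁅y⁆⇒x≡y y x∈y)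

x∈p⇒x∈p∪⁅y⁆ : ∀ {p : Subset n} {x y} → x ∈ p → x ∈ p ∪ ⁅ y ⁆
x∈p⇒x∈p∪⁅y⁆ x∈p = x∈p∪q⁺ (inj₁ x∈p)

y∈p∪⁅y⁆ : ∀ {p : Subset n} {y} → y ∈ p ∪ ⁅ y ⁆
y∈p∪⁅y⁆ {y = y} = x∈p∪q⁺ (inj₂ (x∈⁅x⁆ y))

∣p∪q∣+∣p∩q∣≡∣p∣+∣q∣ : ∀ (p q : Subset n) → ∣ p ∪ q ∣ + ∣ p ∩ q ∣ ≡ ∣ p ∣ + ∣ q ∣
∣p∪q∣+∣p∩q∣≡∣p∣+∣q∣ []            []            = refl
∣p∪q∣+∣p∩q∣≡∣p∣+∣q∣ (outside ∷ p) (outside ∷ q) = ∣p∪q∣+∣p∩q∣≡∣p∣+∣q∣ p q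
∣p∪q∣+∣p∩q∣≡∣p∣+∣q∣ (inside  ∷ p) (outside ∷ q) = cong suc (∣p∪q∣+∣p∩q∣≡∣p∣+∣q∣ p q)
∣p∪q∣+∣p∩q∣≡∣p∣+∣q∣ (outside ∷ p) (inside  ∷ q) =
  trans (cong suc (∣p∪q∣+∣p∩q∣≡∣p∣+∣q∣ p q)) (sym (ℕₚ.+-suc ∣ p ∣ ∣ q ∣))
∣p∪q∣+∣p∩q∣≡∣p∣+∣q∣ (inside  ∷ p) (inside  ∷ q) =
  cong suc (trans (ℕₚ.+-suc ∣ p ∪ q ∣ ∣ p ∩ q ∣)
           (trans (cong suc (∣p∪q∣+∣p∩q∣≡∣p∣+∣q∣ p q)) (sym (ℕₚ.+-suc ∣ p ∣ ∣ q ∣))))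

∣p∪q∣≤∣p∣+∣q∣ : ∀ (p q : Subset n) → ∣ p ∪ q ∣ ≤ ∣ p ∣ + ∣ q ∣
∣p∪q∣≤∣p∣+∣q∣ p q = ≤-trans (ℕₚ.m≤m+n _ ∣ p ∩ q ∣) (ℕₚ.≤-reflexive (∣p∪q∣+∣p∩q∣≡∣p∣+∣q∣ p q))

∣p∪⁅x⁆∣≤1+∣p∣ : ∀ (p : Subset n) x → ∣ p ∪ ⁅ x ⁆ ∣ ≤ suc ∣ p ∣
∣p∪⁅x⁆∣≤1+∣p∣ p x = ≤-trans (∣p∪q∣≤∣p∣+∣q∣ p ⁅ x ⁆)
  (ℕₚ.≤-reflexive (trans (cong (∣ p ∣ +_) (∣⁅x⁆∣≡1 x)) (ℕₚ.+-comm ∣ p ∣ 1)))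

p⊆[p-x]∪⁅x⁆ : ∀ {p : Subset n} {x} → p ⊆ (p - x) ∪ ⁅ x ⁆
p⊆[p-x]∪⁅x⁆ {x = x} {y} y∈p with y ≟ x
... | yes refl = y∈p∪⁅y⁆
... | no  y≢x  = x∈p⇒x∈p∪⁅y⁆ (x∈p∧x≢y⇒x∈p-y y∈p y≢x)

∣p∣≤1+∣p-x∣ : ∀ (p : Subset n) x → ∣ p ∣ ≤ suc ∣ p - x ∣
∣p∣≤1+∣p-x∣ p x = ≤-trans (p⊆q⇒∣p∣≤∣q∣ (p⊆[p-x]∪⁅x⁆ {p = p} {x})) (∣p∪⁅x⁆∣≤1+∣p∣ (p - x) x)

x∉p⇒∣p∣<∣p∪⁅x⁆∣ : ∀ {p : Subset n} {x} → x ∉ p → ∣ p ∣ < ∣ p ∪ ⁅ x ⁆ ∣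
x∉p⇒∣p∣<∣p∪⁅x⁆∣ {p = p} {x} x∉p = p⊂q⇒∣p∣<∣q∣ (x∈p⇒x∈p∪⁅y⁆ , x , y∈p∪⁅y⁆ , x∉p)

0<∣p∣⇒Nonempty : ∀ {p : Subset n} → 0 < ∣ p ∣ → Nonempty p
0<∣p∣⇒Nonempty {n = n} {p} 0<∣p∣ with nonempty? p
... | yes ne = ne
... | no  e  = contradiction
  (subst (0 <_) (trans (cong ∣_∣ (Empty-unique e)) (∣⊥∣≡0 n)) 0<∣p∣) (ℕₚ.<-irrefl refl)

-- Hall's theorem

module Hall {_~_ : Fin n → Fin n → Set} (_~?_ : ∀ u v → Dec (u ~ v)) where

  HasNeighbourIn : Subset n → Fin n → Set
  HasNeighbourIn A y = ∃[ a ] (a ∈ A × a ~ y)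

  InN : Subset n → Subset n → Fin n → Set
  InN Y A y = y ∈ Y × HasNeighbourIn A y

  inN? : ∀ Y A → Decidable (InN Y A)
  inN? Y A y = (y ∈? Y) ×-dec any? (λ a → (a ∈? A) ×-dec (a ~? y))

  -- The right-hand side `Y` is a parameter because the induction deletes vertices from it.
  N : Subset n → Subset n → Subset n
  N Y A = subset (inN? Y A)

  ∈N⁺ : ∀ {Y A y a} → y ∈ Y → a ∈ A → a ~ y → y ∈ N Y A
  ∈N⁺ {Y} {A} y∈Y a∈A a~y = ∈-subset⁺ (inN? Y A) (y∈Y , _ , a∈A , a~y)

  ∈N⁻ : ∀ {Y A y} → y ∈ N Y A → InN Y A y
  ∈N⁻ {Y} {A} = ∈-subset⁻ (inN? Y A)

  N-mono : ∀ {Y A B} → A ⊆ B → N Y A ⊆ N Y B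
  N-mono A⊆B y∈ = let y∈Y , _ , a∈A , a~y = ∈N⁻ y∈ in ∈N⁺ y∈Y (A⊆B a∈A) a~y

  Deficient : Subset n → Subset n → Subset n → Set
  Deficient X Y A = A ⊆ X × ∣ N Y A ∣ < ∣ A ∣

  -- `mate` is total but constrained only on `X`. For `X = Y = V G` it is injective from a finite
  -- set to itself, hence the permutation sought.
  record Matching (X Y : Subset n) : Set where
    field
      mate      : Fin n → Fin n
      mate∈     : ∀ {x} → x ∈ X → mate x ∈ Y
      ~mate     : ∀ {x} → x ∈ X → x ~ mate x
      injective : ∀ {x x′} → x ∈ X → x′ ∈ X → mate x ≡ mate x′ → x ≡ x′

  -- Neighbourhoods commute with unions, while a neighbour of `A ∩ B` is a neighbour of both sets;
  -- the rest is inclusion-exclusion.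
  N-submodular : ∀ Y A B → ∣ N Y (A ∪ B) ∣ + ∣ N Y (A ∩ B) ∣ ≤ ∣ N Y A ∣ + ∣ N Y B ∣
  N-submodular Y A B = ≤-trans
    (ℕₚ.+-mono-≤ (p⊆q⇒∣p∣≤∣q∣ N∪⊆) (p⊆q⇒∣p∣≤∣q∣ N∩⊆))
    (ℕₚ.≤-reflexive (∣p∪q∣+∣p∩q∣≡∣p∣+∣q∣ (N Y A) (N Y B)))
    where
    N∪⊆ : N Y (A ∪ B) ⊆ N Y A ∪ N Y B
    N∪⊆ y∈ with ∈N⁻ y∈
    ... | y∈Y , a , a∈ , a~y with x∈p∪q⁻ A B a∈
    ... | inj₁ a∈A = x∈p∪q⁺ (inj₁ (∈N⁺ y∈Y a∈A a~y))
    ... | inj₂ a∈B = x∈p∪q⁺ (inj₂ (∈N⁺ y∈Y a∈B a~y))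

    N∩⊆ : N Y (A ∩ B) ⊆ N Y A ∩ N Y B
    N∩⊆ y∈ = x∈p∩q⁺ (N-mono (p∩q⊆p A B) y∈ , N-mono (p∩q⊆q A B) y∈)

  N-delete : ∀ {Y A y} → N Y A ⊆ N (Y - y) A ∪ ⁅ y ⁆
  N-delete {y = y} {z} z∈ with z ≟ y
  ... | yes refl = y∈p∪⁅y⁆
  ... | no  z≢y  = let z∈Y , _ , a∈A , a~z = ∈N⁻ z∈ in
    x∈p⇒x∈p∪⁅y⁆ (∈N⁺ (x∈p∧x≢y⇒x∈p-y z∈Y z≢y) a∈A a~z)

  extend : ∀ {X Y x y} → y ∈ Y → x ~ y → Matching (X - x) (Y - y) → Matching X Y
  extend {X} {Y} {x} {y} y∈Y x~y M = record
    { mate = mate′ ; mate∈ = mate′∈ ; ~mate = ~mate′ ; injective = inj′ }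
    where
    open Matching M
    mate′ : Fin n → Fin n
    mate′ z with z ≟ x
    ... | yes _ = y
    ... | no  _ = mate z

    mate′∈ : ∀ {z} → z ∈ X → mate′ z ∈ Y
    mate′∈ {z} z∈X with z ≟ x
    ... | yes _  = y∈Y
    ... | no z≢x = x∈p-y⇒x∈p (mate∈ (x∈p∧x≢y⇒x∈p-y z∈X z≢x))

    ~mate′ : ∀ {z} → z ∈ X → z ~ mate′ z
    ~mate′ {z} z∈X with z ≟ x
    ... | yes refl = x~y
    ... | no z≢x   = ~mate (x∈p∧x≢y⇒x∈p-y z∈X z≢x)

    mate≢y : ∀ {z} → z ∈ X → z ≢ x → mate z ≢ y
    mate≢y z∈X z≢x = x∈p-y⇒x≢y (mate∈ (x∈p∧x≢y⇒x∈p-y z∈X z≢x))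

    inj′ : ∀ {z z′} → z ∈ X → z′ ∈ X → mate′ z ≡ mate′ z′ → z ≡ z′
    inj′ {z} {z′} z∈X z′∈X eq with z ≟ x | z′ ≟ x
    ... | yes refl | yes refl = refl
    ... | yes refl | no z′≢x  = contradiction (sym eq) (mate≢y z′∈X z′≢x)
    ... | no z≢x   | yes refl = contradiction eq (mate≢y z∈X z≢x)
    ... | no z≢x   | no z′≢x  =
      injective (x∈p∧x≢y⇒x∈p-y z∈X z≢x) (x∈p∧x≢y⇒x∈p-y z′∈X z′≢x) eq

  -- Induction on the bound `k` for `∣ X ∣`. Each neighbour `y` of `x` in `Y` is tried as its mate:
  -- either `X - x` can be matched into `Y - y`, or some set is deficient there. If every `y` fails,
  -- these obstructions combine into a set that is deficient in `Y` itself.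
  matching⊎deficient : ∀ k X Y → ∣ X ∣ ≤ k → Matching X Y ⊎ ∃ (Deficient X Y)
  matching⊎deficient k X Y ∣X∣≤k with nonempty? X
  ... | no empty = inj₁ (record
    { mate      = λ x → x
    ; mate∈     = λ x∈X → ⊥-elim (empty (_ , x∈X))
    ; ~mate     = λ x∈X → ⊥-elim (empty (_ , x∈X))
    ; injective = λ x∈X _ _ → ⊥-elim (empty (_ , x∈X)) })
  matching⊎deficient zero X Y ∣X∣≤0 | yes (x , x∈X) =
    contradiction (≤-trans (x∈p⇒∣p-x∣<∣p∣ x∈X) ∣X∣≤0) λ ()
  matching⊎deficient (suc k) X Y ∣X∣≤1+k | yes (x , x∈X) = conclude (tight (allFin n))
    where
    IH : ∀ Y → Matching (X - x) Y ⊎ ∃ (Deficient (X - x) Y)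
    IH Y = matching⊎deficient k (X - x) Y (s≤s⁻¹ (<-≤-trans (x∈p⇒∣p-x∣<∣p∣ x∈X) ∣X∣≤1+k))

    -- Sets A with ∣ N Y A ∣ ≤ ∣ A ∣ are closed under union as long as no set is
    -- deficient. Such sets are collected until they absorb all neighbours of x.
    Tight : List (Fin n) → Set
    Tight ys = ∃[ A ] (A ⊆ X - x × ∣ N Y A ∣ ≤ ∣ A ∣ ×
                       (∀ {y} → y ∈ˡ ys → y ∈ Y → x ~ y → y ∈ N Y A))

    Result : Set → Set
    Result T = (Matching X Y ⊎ ∃ (Deficient X Y)) ⊎ T

    deficient : ∀ A → A ⊆ X - x → ∣ N Y A ∣ < ∣ A ∣ → ∀ {T} → Result T
    deficient A A⊆ lt = inj₁ (inj₂ (A , x∈p-y⇒x∈p ∘ A⊆ , lt))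

    merge : ∀ {y ys} → Tight ys → y ∈ Y → x ~ y → Result (Tight (y ∷ ys))
    merge {y} {ys} (A , A⊆ , NA≤A , absorbs) y∈Y x~y with IH (Y - y)
    ... | inj₁ M = inj₁ (inj₁ (extend y∈Y x~y M))
    ... | inj₂ (B , B⊆ , NB<B) with y ∈? N Y B
    -- The deletion of `y` did not change the neighbourhood of `B`, so `B` is deficient in `Y`
    -- already.
    ... | no y∉NB = deficient B B⊆ (≤-<-trans (p⊆q⇒∣p∣≤∣q∣ NB⊆) NB<B)
      where
      NB⊆ : N Y B ⊆ N (Y - y) B
      NB⊆ z∈ with x∈p∪⁅y⁆⁻ (N-delete z∈)
      ... | inj₁ z∈′  = z∈′
      ... | inj₂ refl = contradiction z∈ y∉NB
    ... | yes y∈NB with ∣ A ∩ B ∣ ≤? ∣ N Y (A ∩ B) ∣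
    ... | no  nle = deficient (A ∩ B) (A⊆ ∘ p∩q⊆p A B) (≰⇒> nle)
    -- Since `A ∩ B` is not deficient, its terms cancel from the submodular inequality and the union
    -- is tight.
    ... | yes le = inj₂ (A ∪ B , [ A⊆ , B⊆ ]′ ∘ x∈p∪q⁻ A B , N∪≤ , absorbs′)
      where
      -- Restoring `y` adds at most one neighbour, which the strict inequality `NB<B` can absorb.
      NB≤B : ∣ N Y B ∣ ≤ ∣ B ∣
      NB≤B = ≤-trans (p⊆q⇒∣p∣≤∣q∣ (N-delete {Y} {B} {y})) (≤-trans (∣p∪⁅x⁆∣≤1+∣p∣ (N (Y - y) B) y) NB<B)

      N∪≤ : ∣ N Y (A ∪ B) ∣ ≤ ∣ A ∪ B ∣
      N∪≤ = ℕₚ.+-cancelʳ-≤ ∣ A ∩ B ∣ _ _ (begin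
        ∣ N Y (A ∪ B) ∣ + ∣ A ∩ B ∣         ≤⟨ ℕₚ.+-monoʳ-≤ _ le ⟩
        ∣ N Y (A ∪ B) ∣ + ∣ N Y (A ∩ B) ∣   ≤⟨ N-submodular Y A B ⟩
        ∣ N Y A ∣ + ∣ N Y B ∣               ≤⟨ ℕₚ.+-mono-≤ NA≤A NB≤B ⟩
        ∣ A ∣ + ∣ B ∣                       ≡⟨ ∣p∪q∣+∣p∩q∣≡∣p∣+∣q∣ A B ⟨
        ∣ A ∪ B ∣ + ∣ A ∩ B ∣               ∎)
        where open ℕₚ.≤-Reasoning

      absorbs′ : ∀ {z} → z ∈ˡ y ∷ ys → z ∈ Y → x ~ z → z ∈ N Y (A ∪ B)
      absorbs′ (here refl) _   _   = N-mono (q⊆p∪q A B) y∈NB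
      absorbs′ (there z∈)  z∈Y x~z = N-mono (p⊆p∪q B) (absorbs z∈ z∈Y x~z)

    tight : ∀ ys → Result (Tight ys)
    tight []       = inj₂ (⊥ , ⊥-elim ∘ ∉⊥ , ∣N⊥∣≤∣⊥∣ , λ ())
      where
      ∣N⊥∣≤∣⊥∣ : ∣ N Y ⊥ ∣ ≤ ∣ ⊥ {n} ∣
      ∣N⊥∣≤∣⊥∣ = p⊆q⇒∣p∣≤∣q∣ {q = ⊥} λ y∈ → ⊥-elim (∉⊥ (proj₁ (proj₂ (proj₂ (∈N⁻ y∈)))))
    tight (y ∷ ys) with tight ys
    ... | inj₁ r = inj₁ r
    ... | inj₂ t@(A , A⊆ , NA≤A , absorbs) with (y ∈? Y) ×-dec (x ~? y)
    ... | yes (y∈Y , x~y) = merge t y∈Y x~y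
    ... | no  ¬p = inj₂ (A , A⊆ , NA≤A , λ
      { (here refl) y∈Y x~y → contradiction (y∈Y , x~y) ¬p
      ; (there z∈)          → absorbs z∈ })

    conclude : Result (Tight (allFin n)) → Matching X Y ⊎ ∃ (Deficient X Y)
    conclude (inj₁ r) = r
    -- All neighbours of `x` lie in `N Y A` already, so adding `x` enlarges `A` but not its
    -- neighbourhood.
    conclude (inj₂ (A , A⊆ , NA≤A , absorbs)) = inj₂ (A ∪ ⁅ x ⁆ , ⊆X , lt)
      where
      ⊆X : A ∪ ⁅ x ⁆ ⊆ X
      ⊆X z∈ with x∈p∪⁅y⁆⁻ z∈
      ... | inj₁ z∈A  = x∈p-y⇒x∈p (A⊆ z∈A)
      ... | inj₂ refl = x∈X

      N⊆ : N Y (A ∪ ⁅ x ⁆) ⊆ N Y A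
      N⊆ z∈ with ∈N⁻ z∈
      ... | z∈Y , a , a∈ , a~z with x∈p∪⁅y⁆⁻ a∈
      ... | inj₁ a∈A  = ∈N⁺ z∈Y a∈A a~z
      ... | inj₂ refl = absorbs (∈-allFin _) z∈Y a~z

      lt : ∣ N Y (A ∪ ⁅ x ⁆) ∣ < ∣ A ∪ ⁅ x ⁆ ∣
      lt = ≤-<-trans (≤-trans (p⊆q⇒∣p∣≤∣q∣ N⊆) NA≤A)
                     (x∉p⇒∣p∣<∣p∪⁅x⁆∣ λ x∈A → x∈p-y⇒x≢y (A⊆ x∈A) refl)

-- Paths, cycles and 2-connected subgraphs

Adj? : (G : Graph n) → ∀ u v → Dec (Adj G u v)
Adj? = Graph._~?_

Adj-sym : (G : Graph n) → Symmetric (Adj G)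
Adj-sym = Graph.~-sym

Adj⇒∈ʳ : (G : Graph n) → ∀ {u v} → Adj G u v → v ∈ V G
Adj⇒∈ʳ G = Graph.~⇒∈V G ∘ Adj-sym G

Adj⇒≢ : (G : Graph n) → ∀ {u v} → Adj G u v → u ≢ v
Adj⇒≢ G u~v u≡v = Graph.~-irrefl G u≡v u~v

Star-sym : (G : Graph n) → Symmetric (Star (Adj G))
Star-sym G = Star.reverse (Adj-sym G)

induced : Graph n → Subset n → Graph n
induced G U = record
  { V        = U
  ; _~_      = λ u v → Adj G u v × u ∈ U × v ∈ U
  ; _~?_     = λ u v → Adj? G u v ×-dec (u ∈? U) ×-dec (v ∈? U)
  ; ~-sym    = λ (u~v , u∈ , v∈) → Adj-sym G u~v , v∈ , u∈
  ; ~-irrefl = λ u≡v (u~v , _) → Graph.~-irrefl G u≡v u~v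
  ; ~⇒∈V     = λ (_ , u∈ , _) → u∈
  }

induced-⊑ : (G : Graph n) → ∀ {U} → U ⊆ V G → induced G U ⊑ G
induced-⊑ G U⊆V = U⊆V , proj₁

⊑-induced : (G K : Graph n) → ∀ {U} → K ⊑ G → V K ⊆ U → K ⊑ induced G U
⊑-induced G K (_ , K⊆G) VK⊆U =
  VK⊆U , λ u~v → K⊆G u~v , VK⊆U (Graph.~⇒∈V K u~v) , VK⊆U (Adj⇒∈ʳ K u~v)

connected-from : (H : Graph n) → ∀ {r} → r ∈ V H → (∀ {u} → u ∈ V H → Star (Adj H) u r) → Connected H
connected-from H r∈ to-r = (_ , r∈) , λ u∈ v∈ → to-r u∈ ◅◅ Star-sym H (to-r v∈)

-- The induced graph has the vertices of `K` and at least its edges, also after a deletion, so walks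
-- in `K` carry over. Thus extensions of a 2-connected subgraph can be searched by vertex set alone.
induced-2-connected : (G K : Graph n) → K ⊑ G → 2-Connected K → 2-Connected (induced G (V K))
induced-2-connected G K K⊑G ((ne , conn) , conn-delete) =
  (ne , λ u∈ v∈ → Star.map K⇒ (conn u∈ v∈)) ,
  λ w∈ → let ne′ , conn′ = conn-delete w∈ in
    ne′ , λ u∈ v∈ → Star.map (λ (u~v , ≢w) → K⇒ u~v , ≢w) (conn′ u∈ v∈)
  where
  K⇒ : ∀ {u v} → Adj K u v → Adj (induced G (V K)) u v
  K⇒ = proj₂ (⊑-induced G K K⊑G λ u∈ → u∈)

⊆-or-∉ : ∀ (p q : Subset n) → p ⊆ q ⊎ ∃[ x ] (x ∈ p × x ∉ q)
⊆-or-∉ p q with any? (λ x → (x ∈? p) ×-dec ¬? (x ∈? q))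
... | yes found = inj₂ found
... | no  none  = inj₁ λ {x} x∈p → decidable-stable (x ∈? q) λ x∉q → none (x , x∈p , x∉q)

-- The inequality `n ≤ k + ∣ U ∣` serves as fuel in the searches below: at most `k` elements lie
-- outside the growing set `U`.
n≤1+k+∣U∣⇒n≤k+∣U∪⁅x⁆∣ : ∀ k {U : Subset n} {x} → n ≤ suc k + ∣ U ∣ → x ∉ U → n ≤ k + ∣ U ∪ ⁅ x ⁆ ∣
n≤1+k+∣U∣⇒n≤k+∣U∪⁅x⁆∣ k {U} n≤ x∉ = 
  ≤-trans n≤ (≤-trans (ℕₚ.≤-reflexive (sym (ℕₚ.+-suc k ∣ U ∣)))
                      (ℕₚ.+-monoʳ-≤ k (x∉p⇒∣p∣<∣p∪⁅x⁆∣ x∉)))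

n≤∣U∣⇒x∈U : ∀ {U : Subset n} {x} → n ≤ ∣ U ∣ → x ∈ U
n≤∣U∣⇒x∈U {n} {U} {x} n≤ = subst (x ∈_) (sym (∣p∣≡n⇒p≡⊤ (ℕₚ.≤-antisym (∣p∣≤n U) n≤))) ∈⊤

-- If some pair of U were nonadjacent, U would have no proper 2-connected
-- extension and hence would be a block, but blocks are cliques.
2-connected⇒clique : (G : Graph n) → IsBlockGraph G → ∀ k (U : Subset n) → n ≤ k + ∣ U ∣ →
                     U ⊆ V G → 2-Connected (induced G U) →
                     ∀ {u v} → u ∈ U → v ∈ U → u ≢ v → Adj G u v
2-connected⇒clique {n} G block k U n≤ U⊆V 2c {u} {v} u∈ v∈ u≢v with Adj? G u v
... | yes u~v = u~v
... | no  u≁v = proj₁ (block (induced G U) (induced-⊑ G U⊆V , 2c , maximal k n≤) u∈ v∈ u≢v)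
  where
  maximal : ∀ k → n ≤ k + ∣ U ∣ → ∀ K → K ⊑ G → 2-Connected K → induced G U ⊑ K → K ⊑ induced G U
  maximal k n≤ K K⊑G 2K (U⊆ , _) with ⊆-or-∉ (V K) U
  ... | inj₁ VK⊆U = ⊑-induced G K K⊑G VK⊆U
  ... | inj₂ (x , x∈ , x∉) with k
  ... | zero   = contradiction (≤-trans (<-≤-trans U<K (∣p∣≤n (V K))) n≤) (ℕₚ.<-irrefl refl)
    where
    U<K : ∣ U ∣ < ∣ V K ∣
    U<K = p⊂q⇒∣p∣<∣q∣ (U⊆ , x , x∈ , x∉)
  -- The recursion runs on `V K`, which is larger than `U` and still contains `u` and `v`, so it
  -- yields the edge that was excluded.
  ... | suc k′ = contradiction
    (2-connected⇒clique G block k′ (V K)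
      (≤-trans n≤ (≤-trans (ℕₚ.≤-reflexive (sym (ℕₚ.+-suc k′ ∣ U ∣)))
                           (ℕₚ.+-monoʳ-≤ k′ (p⊂q⇒∣p∣<∣q∣ (U⊆ , x , x∈ , x∉)))))
      (proj₁ K⊑G) (induced-2-connected G K K⊑G 2K) (U⊆ u∈) (U⊆ v∈) u≢v)
    u≁v

-- The last index is the vertex set of the path; the freshness condition `x ∉ U` keeps the path
-- simple.
data Path (R : Rel (Fin n) 0ℓ) : Fin n → Fin n → Subset n → Set where
  [_] : ∀ x → Path R x x ⁅ x ⁆
  _∷_ : ∀ {x y z U} → R x y × x ∉ U → Path R y z U → Path R x z (U ∪ ⁅ x ⁆)

module _ {R : Rel (Fin n) 0ℓ} where

  head∈ : ∀ {x z U} → Path R x z U → x ∈ U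
  head∈ [ x ]   = x∈⁅x⁆ x
  head∈ (_ ∷ _) = y∈p∪⁅y⁆

  last∈ : ∀ {x z U} → Path R x z U → z ∈ U
  last∈ [ x ]   = x∈⁅x⁆ x
  last∈ (_ ∷ p) = x∈p⇒x∈p∪⁅y⁆ (last∈ p)

  path-vertices : ∀ {x z U} {P : Fin n → Set} → (∀ {u v} → R u v → P u × P v) →
                  P z → Path R x z U → ∀ {u} → u ∈ U → P u
  path-vertices R⇒P pz [ x ] u∈ with refl ← x∈⁅y⁆⇒x≡y x u∈ = pz
  path-vertices R⇒P pz ((xRy , _) ∷ p) u∈ with x∈p∪⁅y⁆⁻ u∈
  ... | inj₁ u∈′  = path-vertices R⇒P pz p u∈′
  ... | inj₂ refl = proj₁ (R⇒P xRy)

  -- The initial segment that ends at the predecessor of `y`. It is what remains of a path when it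
  -- is closed to a cycle through `y`.
  cut : ∀ {x z U y} → Path R x z U → y ∈ U → y ≢ x →
        ∃[ z′ ] ∃[ U′ ] (Path R x z′ U′ × R z′ y × y ∉ U′ × U′ ⊆ U)
  cut [ x ] y∈ y≢x = contradiction (x∈⁅y⁆⇒x≡y x y∈) y≢x
  cut {y = y} (_∷_ {x} {x′} (xRx′ , x∉) p) y∈ y≢x with y ≟ x′ | x∈p∪⁅y⁆⁻ y∈
  ... | _        | inj₂ y≡x = contradiction y≡x y≢x
  ... | yes refl | inj₁ _   =
    x , ⁅ x ⁆ , [ x ] , xRx′ , x≢y⇒x∉⁅y⁆ y≢x ,
    λ u∈ → subst (_∈ _) (sym (x∈⁅y⁆⇒x≡y x u∈)) y∈p∪⁅y⁆
  ... | no y≢x′  | inj₁ y∈′ =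
    let z′ , U′ , p′ , z′Ry , y∉ , U′⊆ = cut p y∈′ y≢x′ in
    z′ , U′ ∪ ⁅ x ⁆ , (xRx′ , x∉ ∘ U′⊆) ∷ p′ , z′Ry ,
    [ y∉ , y≢x ]′ ∘ x∈p∪⁅y⁆⁻ ,
    λ u∈ → [ x∈p⇒x∈p∪⁅y⁆ ∘ U′⊆ , (λ { refl → y∈p∪⁅y⁆ }) ]′ (x∈p∪⁅y⁆⁻ u∈)

  reach-last : (H : Graph n) → ∀ {x z U} →
               (∀ {u v} → R u v → u ∈ U → v ∈ U → Adj H u v) → Path R x z U →
               ∀ {u} → u ∈ U → Star (Adj H) u z
  reach-last H R⇒ [ x ] u∈ with refl ← x∈⁅y⁆⇒x≡y x u∈ = ε
  reach-last H R⇒ ((xRy , _) ∷ p) u∈ with x∈p∪⁅y⁆⁻ u∈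
  ... | inj₁ u∈′  = reach-last H (λ r u∈ v∈ → R⇒ r (x∈p⇒x∈p∪⁅y⁆ u∈) (x∈p⇒x∈p∪⁅y⁆ v∈)) p u∈′
  ... | inj₂ refl = R⇒ xRy y∈p∪⁅y⁆ (x∈p⇒x∈p∪⁅y⁆ (head∈ p)) ◅
    reach-last H (λ r u∈ v∈ → R⇒ r (x∈p⇒x∈p∪⁅y⁆ u∈) (x∈p⇒x∈p∪⁅y⁆ v∈)) p (head∈ p)

  -- Deleting `w` breaks a simple path into at most two pieces, and each of them contains an end of
  -- the path other than `w`.
  reach-end : (H : Graph n) → ∀ {x z U w} →
              (∀ {u v} → R u v → u ∈ U → v ∈ U → u ≢ w → v ≢ w → Adj H u v) → Path R x z U →
              ∀ {u} → u ∈ U → u ≢ w → (x ≢ w × Star (Adj H) u x) ⊎ (z ≢ w × Star (Adj H) u z)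
  reach-end H R⇒ [ x ] u∈ u≢w with refl ← x∈⁅y⁆⇒x≡y x u∈ = inj₁ (u≢w , ε)
  reach-end H {w = w} R⇒ (_∷_ {x} {U = U} (xRy , x∉) p) {u} u∈ u≢w with x∈p∪⁅y⁆⁻ u∈
  ... | inj₂ refl = inj₁ (u≢w , ε)
  ... | inj₁ u∈′ with x ≟ w
  -- The head is deleted. By simplicity the rest of the path avoids `w`, so it leads to `z` intact.
  ... | yes refl = inj₂ ((λ { refl → x∉ (last∈ p) }) ,
    reach-last H (λ r u∈ v∈ → R⇒ r (x∈p⇒x∈p∪⁅y⁆ u∈) (x∈p⇒x∈p∪⁅y⁆ v∈)
                                   (λ { refl → x∉ u∈ }) (λ { refl → x∉ v∈ })) p u∈′)
  ... | no x≢w with reach-end H (λ r u∈ v∈ → R⇒ r (x∈p⇒x∈p∪⁅y⁆ u∈) (x∈p⇒x∈p∪⁅y⁆ v∈)) p u∈′ u≢w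
  ... | inj₁ (y≢w , u⇝y) = inj₁ (x≢w , u⇝y ◅◅
    Star-sym H (R⇒ xRy y∈p∪⁅y⁆ (x∈p⇒x∈p∪⁅y⁆ (head∈ p)) x≢w y≢w ◅ ε))
  ... | inj₂ r = inj₂ r

  -- The vertex `y` closes the path to a cycle. Without `y` the path itself connects what is left;
  -- without another vertex, every remaining vertex still reaches a surviving end of the path, and
  -- from there `y`.
  cycle-2-connected : (G : Graph n) → (∀ {u v} → R u v → Adj G u v) →
                      ∀ {x y z U} → Path R x z U → y ∉ U → Adj G x y → Adj G z y →
                      2-Connected (induced G (U ∪ ⁅ y ⁆))
  cycle-2-connected G R⇒ {x} {y} {z} {U} p y∉ x~y z~y =
    connected-from H y∈p∪⁅y⁆ to-y , connected-delete
    where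
    H : Graph n
    H = induced G (U ∪ ⁅ y ⁆)

    R⇒H : ∀ {u v} → R u v → u ∈ U → v ∈ U → Adj H u v
    R⇒H r u∈ v∈ = R⇒ r , x∈p⇒x∈p∪⁅y⁆ u∈ , x∈p⇒x∈p∪⁅y⁆ v∈

    end~y : ∀ {e} → e ∈ U → Adj G e y → Adj H e y
    end~y e∈ e~y = e~y , x∈p⇒x∈p∪⁅y⁆ e∈ , y∈p∪⁅y⁆

    ∈U⇒≢y : ∀ {u} → u ∈ U → u ≢ y
    ∈U⇒≢y u∈ refl = y∉ u∈

    to-y : ∀ {u} → u ∈ V H → Star (Adj H) u y
    to-y u∈ with x∈p∪⁅y⁆⁻ u∈
    ... | inj₂ refl = ε
    ... | inj₁ u∈′  = reach-last H R⇒H p u∈′ ◅◅ (end~y (last∈ p) z~y ◅ ε)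

    connected-delete : ∀ {w} → w ∈ V H → Connected (delete H w)
    connected-delete {w} w∈ with w ≟ y
    ... | yes refl = connected-from (delete H y)
      (x∈p∧x≢y⇒x∈p-y (x∈p⇒x∈p∪⁅y⁆ (last∈ p)) (∈U⇒≢y (last∈ p))) to-last
      where
      to-last : ∀ {u} → u ∈ V (delete H y) → Star (Adj (delete H y)) u z
      to-last u∈ with x∈p∪⁅y⁆⁻ (x∈p-y⇒x∈p u∈)
      ... | inj₂ refl = contradiction refl (x∈p-y⇒x≢y u∈)
      ... | inj₁ u∈′  =
        reach-last (delete H y) (λ r u∈ v∈ → R⇒H r u∈ v∈ , ∈U⇒≢y u∈ , ∈U⇒≢y v∈) p u∈′
    ... | no w≢y = connected-from (delete H w) (x∈p∧x≢y⇒x∈p-y y∈p∪⁅y⁆ (≢-sym w≢y)) to-y′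
      where
      to-y′ : ∀ {u} → u ∈ V (delete H w) → Star (Adj (delete H w)) u y
      to-y′ u∈ with x∈p∪⁅y⁆⁻ (x∈p-y⇒x∈p u∈)
      ... | inj₂ refl = ε
      ... | inj₁ u∈′ with reach-end (delete H w)
                            (λ r u∈ v∈ u≢w v≢w → R⇒H r u∈ v∈ , u≢w , v≢w) p u∈′ (x∈p-y⇒x≢y u∈)
      ... | inj₁ (x≢w , u⇝x) = u⇝x ◅◅ ((end~y (head∈ p) x~y , x≢w , ≢-sym w≢y) ◅ ε)
      ... | inj₂ (z≢w , u⇝z) = u⇝z ◅◅ ((end~y (last∈ p) z~y , z≢w , ≢-sym w≢y) ◅ ε)

  -- The cycle runs `x`, `x′`, along the path to `z`, then `y` and back to `x`. The part around `x`
  -- and `y` is spelled out because the sides of these vertices decide the later case distinction.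
  record Cycle : Set where
    field
      {x x′ y z} : Fin n
      {U}        : Subset n
      xRx′       : R x x′
      x∉U        : x ∉ U
      path       : Path R x′ z U
      zRy        : R z y
      y∉U        : y ∉ U
      xRy        : R x y

  -- A path that can always be prolonged at its head without turning back must
  -- run into itself.
  cycle : Symmetric R → (W : Subset n) → (∀ {u} → u ∈ W → ∀ w → ∃[ v ] (v ∈ W × R u v × v ≢ w)) →
          (∀ {u v} → R u v → u ≢ v) → Nonempty W → Cycle
  cycle R-sym W branch R⇒≢ (w₀ , w₀∈) =
    let v , v∈ , w₀Rv , v≢w₀ = branch w₀∈ w₀ in
    search n v∈ (R-sym w₀Rv) (x≢y⇒x∉⁅y⁆ v≢w₀) [ w₀ ] (ℕₚ.m≤m+n n _)
    where
    search : ∀ k {x x′ z U} → x ∈ W → R x x′ → x ∉ U → Path R x′ z U → n ≤ k + ∣ U ∣ → Cycle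
    search zero    _  _    x∉ _ n≤ = contradiction (n≤∣U∣⇒x∈U n≤) x∉
    search (suc k) {x′ = x′} {U = U} x∈ xRx′ x∉ p n≤ with branch x∈ x′
    ... | y , y∈ , xRy , y≢x′ with y ∈? U
    ... | no  y∉U = search k y∈ (R-sym xRy) ([ y∉U , R⇒≢ (R-sym xRy) ]′ ∘ x∈p∪⁅y⁆⁻)
                          ((xRx′ , x∉) ∷ p) (n≤1+k+∣U∣⇒n≤k+∣U∪⁅x⁆∣ k n≤ x∉)
    -- The new neighbour `y` of `x` is on the path. The segment from `x′` to the predecessor of `y`
    -- closes up through `y` and `x`.
    ... | yes y∈U = let z , U′ , p′ , zRy , y∉ , U′⊆ = cut p y∈U y≢x′ in
      record { xRx′ = xRx′ ; x∉U = x∉ ∘ U′⊆ ; path = p′ ; zRy = zRy ; y∉U = y∉ ; xRy = xRy }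

-- Staller's strategy

Independent : Graph n → Subset n → Set
Independent G I = ∀ {u v} → u ∈ I → v ∈ I → ¬ Adj G u v

module _ {n} (G : Graph n) (block : IsBlockGraph G) where

  -- Two neighbours for every vertex would force a cycle. Its vertices lie in a clique, but it
  -- contains two distinct vertices of the independent set `I`.
  bipartite-acyclic : ∀ {I T} → I ⊆ V G → Independent G I → (∀ {u} → u ∈ I → u ∉ T) →
    (∀ {i} → i ∈ I → ∀ w → ∃[ t ] (t ∈ T × Adj G i t × t ≢ w)) →
    (∀ {t} → t ∈ T → ∀ w → ∃[ i ] (i ∈ I × Adj G i t × i ≢ w)) →
    ¬ Nonempty I
  bipartite-acyclic {I} {T} I⊆V indep disjoint branchI branchT (i₀ , i₀∈) =
    impossible (cycle R-sym (I ∪ T) branch (Adj⇒≢ G ∘ proj₁) (_ , x∈p∪q⁺ (inj₁ i₀∈)))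
    where
    R : Rel (Fin n) 0ℓ
    R u v = Adj G u v × ((u ∈ I × v ∈ T) ⊎ (u ∈ T × v ∈ I))

    R-sym : Symmetric R
    R-sym (u~v , inj₁ (u∈ , v∈)) = Adj-sym G u~v , inj₂ (v∈ , u∈)
    R-sym (u~v , inj₂ (u∈ , v∈)) = Adj-sym G u~v , inj₁ (v∈ , u∈)

    branch : ∀ {u} → u ∈ I ∪ T → ∀ w → ∃[ v ] (v ∈ I ∪ T × R u v × v ≢ w)
    branch u∈ w with x∈p∪q⁻ I T u∈
    ... | inj₁ u∈I = let t , t∈ , u~t , t≢w = branchI u∈I w in
      t , x∈p∪q⁺ (inj₂ t∈) , (u~t , inj₁ (u∈I , t∈)) , t≢w
    ... | inj₂ u∈T = let i , i∈ , i~u , i≢w = branchT u∈T w in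
      i , x∈p∪q⁺ (inj₁ i∈) , (Adj-sym G i~u , inj₂ (u∈T , i∈)) , i≢w

    impossible : ¬ Cycle {R = R}
    impossible c = conflict xRx′ xRy
      where
      open Cycle c

      vertices : Subset n
      vertices = (U ∪ ⁅ x ⁆) ∪ ⁅ y ⁆

      y∉ : y ∉ U ∪ ⁅ x ⁆
      y∉ = [ y∉U , Adj⇒≢ G (proj₁ (R-sym xRy)) ]′ ∘ x∈p∪⁅y⁆⁻

      clique : ∀ {u v} → u ∈ vertices → v ∈ vertices → u ≢ v → Adj G u v
      clique = 2-connected⇒clique G block n vertices (ℕₚ.m≤m+n n _) ⊆V
        (cycle-2-connected G proj₁ ((xRx′ , x∉U) ∷ path) y∉ (proj₁ xRy) (proj₁ zRy))
        where
        ⊆V : vertices ⊆ V G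
        ⊆V u∈ with x∈p∪⁅y⁆⁻ u∈
        ... | inj₂ refl = Adj⇒∈ʳ G (proj₁ xRy)
        ... | inj₁ u∈′  =
          path-vertices {P = _∈ V G} (λ (u~v , _) → Graph.~⇒∈V G u~v , Adj⇒∈ʳ G u~v)
            (Graph.~⇒∈V G (proj₁ zRy)) ((xRx′ , x∉U) ∷ path) u∈′

      U⊆ : U ⊆ vertices
      U⊆ = x∈p⇒x∈p∪⁅y⁆ ∘ x∈p⇒x∈p∪⁅y⁆

      -- If `x` is in `T`, the two vertices of `I` are its neighbours `x′` and `y`. If `x` is in
      -- `I`, then `y` is in `T`, and they are the neighbours `x` and `z` of `y`.
      conflict : R x x′ → R x y → Absurd
      conflict (_ , inj₁ (x∈I , _)) (_ , inj₂ (x∈T , _)) = disjoint x∈I x∈T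
      conflict (_ , inj₂ (x∈T , _)) (_ , inj₁ (x∈I , _)) = disjoint x∈I x∈T
      conflict (_ , inj₂ (_ , x′∈I)) (_ , inj₂ (_ , y∈I)) = indep x′∈I y∈I
        (clique (U⊆ (head∈ path)) y∈p∪⁅y⁆ λ { refl → y∉U (head∈ path) })
      conflict (_ , inj₁ (x∈I , _)) (_ , inj₁ (_ , y∈T)) with proj₂ zRy
      ... | inj₂ (_ , y∈I) = disjoint y∈I y∈T
      ... | inj₁ (z∈I , _) = indep x∈I z∈I
        (clique (x∈p⇒x∈p∪⁅y⁆ y∈p∪⁅y⁆) (U⊆ (last∈ path)) λ { refl → x∉U (last∈ path) })

module StallerStrategy {n} (G : Graph n) (block : IsBlockGraph G) where

  Disjoint : Subset n → Subset n → Set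
  Disjoint p q = ∀ {x} → x ∈ p → x ∉ q

  disjoint-claimˡ : ∀ {D S v} → Disjoint D S → v ∉ S → Disjoint (D ∪ ⁅ v ⁆) S
  disjoint-claimˡ D∩S v∉S x∈ x∈S with x∈p∪⁅y⁆⁻ x∈
  ... | inj₁ x∈D  = D∩S x∈D x∈S
  ... | inj₂ refl = v∉S x∈S

  disjoint-claimʳ : ∀ {D S v} → Disjoint D S → v ∉ D → Disjoint D (S ∪ ⁅ v ⁆)
  disjoint-claimʳ D∩S v∉D x∈D x∈ with x∈p∪⁅y⁆⁻ x∈
  ... | inj₁ x∈S  = D∩S x∈D x∈S
  ... | inj₂ refl = v∉D x∈D

  -- No later move can dominate `i`, so induction over the strategy tree never meets a justified
  -- `won`.
  surrounded-lost : ∀ {i p D S} → i ∈ V G → i ∈ S → (∀ {u} → Adj G u i → u ∈ S) →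
                    Disjoint D S → ¬ DominatorWins G p D S
  surrounded-lost i∈V i∈S N⊆S D∩S (won dom) with dom i∈V
  ... | inj₁ i∈D              = D∩S i∈D i∈S
  ... | inj₂ (u , u∈D , u~i)  = D∩S u∈D (N⊆S u~i)
  surrounded-lost i∈V i∈S N⊆S D∩S (move v (_ , _ , v∉S) w) =
    surrounded-lost i∈V i∈S N⊆S (disjoint-claimˡ D∩S v∉S) w
  -- Staller may take any free vertex here; the one stored in `answer` will do.
  surrounded-lost i∈V i∈S N⊆S D∩S (answer (v , v-free@(_ , v∉D , _)) w) =
    surrounded-lost i∈V (x∈p⇒x∈p∪⁅y⁆ i∈S) (x∈p⇒x∈p∪⁅y⁆ ∘ N⊆S) (disjoint-claimʳ D∩S v∉D)
      (w v v-free)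

  almost-surrounded-lost : ∀ {i D S} → i ∈ V G → i ∉ D → i ∉ S → (∀ {u} → Adj G u i → u ∈ S) →
                           Disjoint D S → ¬ DominatorWins G staller D S
  almost-surrounded-lost i∈V i∉D i∉S N⊆S D∩S (won dom) with dom i∈V
  ... | inj₁ i∈D             = i∉D i∈D
  ... | inj₂ (u , u∈D , u~i) = D∩S u∈D (N⊆S u~i)
  almost-surrounded-lost {i} i∈V i∉D i∉S N⊆S D∩S (answer _ w) =
    surrounded-lost i∈V y∈p∪⁅y⁆ (x∈p⇒x∈p∪⁅y⁆ ∘ N⊆S) (disjoint-claimʳ D∩S i∉D)
      (w i (i∈V , i∉D , i∉S))

  -- The invariant of Staller's attack. The vertices of `I` and `T` are free, and nothing in `I` is
  -- dominated yet, as each neighbour is in `T` or belongs to Staller.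
  record Threat (D S I T : Subset n) : Set where
    field
      I⊆V   : I ⊆ V G
      T⊆V   : T ⊆ V G
      indep : Independent G I
      I∩T   : Disjoint I T
      D∩S   : Disjoint D S
      I∩D   : Disjoint I D
      I∩S   : Disjoint I S
      T∩D   : Disjoint T D
      T∩S   : Disjoint T S
      N⊆    : ∀ {i u} → i ∈ I → Adj G i u → u ∈ T ⊎ u ∈ S

  undominated : ∀ {D S I T i} → Threat D S I T → i ∈ I → ¬ Dominating G D
  undominated th i∈ dom with dom (Threat.I⊆V th i∈)
  ... | inj₁ i∈D = Threat.I∩D th i∈ i∈D
  ... | inj₂ (u , u∈D , u~i) with Threat.N⊆ th i∈ (Adj-sym G u~i)
  ... | inj₁ u∈T = Threat.T∩D th u∈T u∈D
  ... | inj₂ u∈S = Threat.D∩S th u∈D u∈S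

  -- Dominator's vertex `i` comes from `I`, hence is neither in `T` nor in `S`, so it dominates no
  -- other vertex of `I`.
  forced : ∀ {D S I T i t} → Threat D S I T → i ∈ I → t ∈ T →
           (∀ {u} → u ∈ T → Adj G i u → u ≡ t) →
           Threat (D ∪ ⁅ i ⁆) (S ∪ ⁅ t ⁆) (I - i) (T - t)
  forced {D} {S} {I} {T} {i} {t} th i∈ t∈ only = record
    { I⊆V   = I⊆V ∘ x∈p-y⇒x∈p
    ; T⊆V   = T⊆V ∘ x∈p-y⇒x∈p
    ; indep = λ u∈ v∈ → indep (x∈p-y⇒x∈p u∈) (x∈p-y⇒x∈p v∈)
    ; I∩T   = λ u∈ v∈ → I∩T (x∈p-y⇒x∈p u∈) (x∈p-y⇒x∈p v∈)
    ; D∩S   = disjoint-claimˡ (disjoint-claimʳ D∩S (T∩D t∈))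
                ([ I∩S i∈ , (λ { refl → I∩T i∈ t∈ }) ]′ ∘ x∈p∪⁅y⁆⁻)
    ; I∩D   = λ u∈ → [ I∩D (x∈p-y⇒x∈p u∈) , x∈p-y⇒x≢y u∈ ]′ ∘ x∈p∪⁅y⁆⁻
    ; I∩S   = λ u∈ → [ I∩S (x∈p-y⇒x∈p u∈) , (λ { refl → I∩T (x∈p-y⇒x∈p u∈) t∈ }) ]′ ∘ x∈p∪⁅y⁆⁻
    ; T∩D   = λ u∈ → [ T∩D (x∈p-y⇒x∈p u∈) , (λ { refl → I∩T i∈ (x∈p-y⇒x∈p u∈) }) ]′ ∘ x∈p∪⁅y⁆⁻
    ; T∩S   = λ u∈ → [ T∩S (x∈p-y⇒x∈p u∈) , x∈p-y⇒x≢y u∈ ]′ ∘ x∈p∪⁅y⁆⁻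
    ; N⊆    = N⊆′
    }
    where
    open Threat th
    N⊆′ : ∀ {j u} → j ∈ I - i → Adj G j u → u ∈ T - t ⊎ u ∈ S ∪ ⁅ t ⁆
    N⊆′ {u = u} j∈ j~u with N⊆ (x∈p-y⇒x∈p j∈) j~u | u ≟ t
    ... | _        | yes refl = inj₂ y∈p∪⁅y⁆
    ... | inj₁ u∈T | no u≢t   = inj₁ (x∈p∧x≢y⇒x∈p-y u∈T u≢t)
    ... | inj₂ u∈S | no _     = inj₂ (x∈p⇒x∈p∪⁅y⁆ u∈S)

  -- No move is made: once `i` is dropped, no vertex left in `I` has `t` as a neighbour.
  pruned : ∀ {D S I T i t} → Threat D S I T →
           (∀ {u} → u ∈ I → Adj G u t → u ≡ i) → Threat D S (I - i) (T - t)
  pruned {S = S} {I} {T} {i} {t} th only = record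
    { I⊆V   = I⊆V ∘ x∈p-y⇒x∈p
    ; T⊆V   = T⊆V ∘ x∈p-y⇒x∈p
    ; indep = λ u∈ v∈ → indep (x∈p-y⇒x∈p u∈) (x∈p-y⇒x∈p v∈)
    ; I∩T   = λ u∈ v∈ → I∩T (x∈p-y⇒x∈p u∈) (x∈p-y⇒x∈p v∈)
    ; D∩S   = D∩S
    ; I∩D   = I∩D ∘ x∈p-y⇒x∈p
    ; I∩S   = I∩S ∘ x∈p-y⇒x∈p
    ; T∩D   = T∩D ∘ x∈p-y⇒x∈p
    ; T∩S   = T∩S ∘ x∈p-y⇒x∈p
    ; N⊆    = N⊆′
    }
    where
    open Threat th
    N⊆′ : ∀ {j u} → j ∈ I - i → Adj G j u → u ∈ T - t ⊎ u ∈ S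
    N⊆′ j∈ j~u with N⊆ (x∈p-y⇒x∈p j∈) j~u
    ... | inj₂ u∈S = inj₂ u∈S
    ... | inj₁ u∈T = inj₁ (x∈p∧x≢y⇒x∈p-y u∈T
      λ { refl → x∈p-y⇒x≢y j∈ (only (x∈p-y⇒x∈p j∈) j~u) })

  -- `w` itself need not be a neighbour of `v`, so a vertex of degree zero counts as a leaf too.
  AtMostOne : Subset n → Fin n → Fin n → Set
  AtMostOne A v w = ∀ u → u ∈ A → Adj G v u → u ≡ w

  atMostOne? : ∀ A v w → Dec (AtMostOne A v w)
  atMostOne? A v w = all? λ u → (u ∈? A) →-dec Adj? G v u →-dec (u ≟ w)

  -- Degree at least two, in the form in which a path is prolonged without turning back to `w`.
  twoNeighbours : ∀ {A v} → ¬ ∃ (AtMostOne A v) → ∀ w → ∃[ u ] (u ∈ A × Adj G v u × u ≢ w)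
  twoNeighbours {A} {v} none w with any? (λ u → (u ∈? A) ×-dec Adj? G v u ×-dec ¬? (u ≟ w))
  ... | yes found = found
  ... | no  ¬u    = contradiction
    (w , λ u u∈ v~u → decidable-stable (u ≟ w) λ u≢w → ¬u (u , u∈ , v~u , u≢w)) none

  leaf? : ∀ A B → Dec (∃[ v ] (v ∈ A × ∃ (AtMostOne B v)))
  leaf? A B = any? λ v → (v ∈? A) ×-dec any? (atMostOne? B v)

  -- `T` loses an element for certain, `I` loses at most one.
  ∣T-t∣<∣I-i∣ : ∀ (I : Subset n) i {T : Subset n} {t} → ∣ T ∣ < ∣ I ∣ → t ∈ T → ∣ T - t ∣ < ∣ I - i ∣
  ∣T-t∣<∣I-i∣ I i T<I t∈ =
    s≤s⁻¹ (≤-trans (s≤s (x∈p⇒∣p-x∣<∣p∣ t∈)) (≤-trans T<I (∣p∣≤1+∣p-x∣ I i)))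

  staller-wins : ∀ k {D S I T} → ∣ T ∣ < k → ∣ T ∣ < ∣ I ∣ → Threat D S I T →
                 ¬ DominatorWins G staller D S
  staller-wins zero () _ _
  staller-wins (suc k) {D} {S} {I} {T} T≤k T<I th dw with leaf? I T
  ... | yes (i , i∈ , t , only) = play dw
    where
    open Threat th

    reply : t ∈ T → Adj G i t → ¬ DominatorWins G dominator D (S ∪ ⁅ t ⁆)
    reply _  _   (won dom) = undominated th i∈ dom
    reply t∈ i~t (move v (_ , v∉D , v∉S∪t) w) with v ≟ i
    ... | yes refl = staller-wins k (<-≤-trans (x∈p⇒∣p-x∣<∣p∣ t∈) (s≤s⁻¹ T≤k))
                       (∣T-t∣<∣I-i∣ I i T<I t∈) (forced th i∈ t∈ λ {u} → only u) w
    -- Dominator has ignored the threat: all neighbours of `i` are now Staller's, who claims `i`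
    -- next.
    ... | no v≢i = almost-surrounded-lost (I⊆V i∈)
      ([ I∩D i∈ , ≢-sym v≢i ]′ ∘ x∈p∪⁅y⁆⁻)
      ([ I∩S i∈ , (λ { refl → I∩T i∈ t∈ }) ]′ ∘ x∈p∪⁅y⁆⁻)
      surrounded
      (disjoint-claimˡ (disjoint-claimʳ D∩S (T∩D t∈)) v∉S∪t) w
      where
      surrounded : ∀ {u} → Adj G u i → u ∈ S ∪ ⁅ t ⁆
      surrounded u~i with N⊆ i∈ (Adj-sym G u~i)
      ... | inj₂ u∈S = x∈p⇒x∈p∪⁅y⁆ u∈S
      ... | inj₁ u∈T with refl ← only _ u∈T (Adj-sym G u~i) = y∈p∪⁅y⁆

    play : ¬ DominatorWins G staller D S
    play (won dom) = undominated th i∈ dom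
    play dw@(answer _ w) with (t ∈? T) ×-dec Adj? G i t
    ... | yes (t∈ , i~t) = reply t∈ i~t (w t (T⊆V t∈ , T∩D t∈ , T∩S t∈))
    -- The only candidate for a neighbour of `i` in `T` fails, so `i` can be claimed at once.
    ... | no  ¬t = almost-surrounded-lost (I⊆V i∈) (I∩D i∈) (I∩S i∈) surrounded D∩S dw
      where
      surrounded : ∀ {u} → Adj G u i → u ∈ S
      surrounded u~i with N⊆ i∈ (Adj-sym G u~i)
      ... | inj₂ u∈S = u∈S
      ... | inj₁ u∈T with refl ← only _ u∈T (Adj-sym G u~i) =
        contradiction (u∈T , Adj-sym G u~i) ¬t
  ... | no noLeafI with leaf? T I
  ... | yes (t , t∈ , i , only) =
    staller-wins k (<-≤-trans (x∈p⇒∣p-x∣<∣p∣ t∈) (s≤s⁻¹ T≤k)) (∣T-t∣<∣I-i∣ I i T<I t∈)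
      (pruned th λ u∈ u~t → only _ u∈ (Adj-sym G u~t)) dw
  -- Without leaves on either side all degrees are at least two, which is impossible as `I` is
  -- nonempty.
  ... | no noLeafT = bipartite-acyclic G block I⊆V indep I∩T
    (λ {i} i∈ → twoNeighbours λ (w , p) → noLeafI (i , i∈ , w , p))
    (λ {t} t∈ w → let i , i∈ , t~i , i≢w = twoNeighbours (λ (w , p) → noLeafT (t , t∈ , w , p)) w
                  in i , i∈ , Adj-sym G t~i , i≢w)
    (0<∣p∣⇒Nonempty (≤-<-trans z≤n T<I))
    where open Threat th

  open Hall (Adj? G)

  -- `T` and `J` are disjoint subsets of the neighbourhood of `A`, so `∣ T ∣ + ∣ J ∣` is below
  -- `∣ A ∣`, which is at most `∣ I ∣ + ∣ J ∣`. Cancelling `J` leaves a position to which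
  -- `staller-wins` applies.
  deficient⇒staller-wins : ∀ {A} → Deficient (V G) (V G) A → ¬ DominatorWins G staller ⊥ ⊥
  deficient⇒staller-wins {A} (A⊆V , NA<A) = staller-wins (suc ∣ T ∣) ≤-refl T<I record
    { I⊆V   = A⊆V ∘ I⊆A
    ; T⊆V   = proj₁ ∘ ∈N⁻
    ; indep = λ u∈ v∈ u~v → I∌N v∈ (∈N⁺ (A⊆V (I⊆A v∈)) (I⊆A u∈) u~v)
    ; I∩T   = λ u∈ u∈T → I∌N u∈ (N-mono I⊆A u∈T)
    ; D∩S   = ∉⊥′
    ; I∩D   = λ _ → ∉⊥
    ; I∩S   = λ _ → ∉⊥
    ; T∩D   = λ _ → ∉⊥
    ; T∩S   = λ _ → ∉⊥
    ; N⊆    = λ i∈ i~u → inj₁ (∈N⁺ (Adj⇒∈ʳ G i~u) i∈ i~u)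
    }
    where
    I J T : Subset n
    I = A ─ N (V G) A
    J = A ∩ N (V G) A
    T = N (V G) I

    ∉⊥′ : Disjoint ⊥ ⊥
    ∉⊥′ x∈ = contradiction x∈ ∉⊥

    I⊆A : I ⊆ A
    I⊆A = p─q⊆p A (N (V G) A)

    I∌N : ∀ {u} → u ∈ I → u ∉ N (V G) A
    I∌N = x∈p─q⇒x∉q A (N (V G) A)

    A⊆I∪J : A ⊆ I ∪ J
    A⊆I∪J {u} u∈ with u ∈? N (V G) A
    ... | yes u∈N = x∈p∪q⁺ (inj₂ (x∈p∩q⁺ (u∈ , u∈N)))
    ... | no  u∉N = x∈p∪q⁺ (inj₁ (x∈p∧x∉q⇒x∈p─q u∈ u∉N))

    T∪J⊆NA : T ∪ J ⊆ N (V G) A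
    T∪J⊆NA = [ N-mono I⊆A , p∩q⊆q A (N (V G) A) ]′ ∘ x∈p∪q⁻ T J

    -- A common vertex would be a neighbour in `A` of some `i` in `I`, but `I` avoids `N (V G) A`.
    T∩J⊆⊥ : T ∩ J ⊆ ⊥
    T∩J⊆⊥ u∈ with x∈p∩q⁻ T J u∈
    ... | u∈T , u∈J with ∈N⁻ u∈T
    ... | u∈V , i , i∈ , i~u = contradiction
      (∈N⁺ (A⊆V (I⊆A i∈)) (p∩q⊆p A (N (V G) A) u∈J) (Adj-sym G i~u)) (I∌N i∈)

    T<I : ∣ T ∣ < ∣ I ∣
    T<I = ℕₚ.+-cancelʳ-< (∣ J ∣) _ _ (begin-strict
      ∣ T ∣ + ∣ J ∣              ≡⟨ ∣p∪q∣+∣p∩q∣≡∣p∣+∣q∣ T J ⟨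
      ∣ T ∪ J ∣ + ∣ T ∩ J ∣      ≤⟨ ℕₚ.+-mono-≤ (p⊆q⇒∣p∣≤∣q∣ T∪J⊆NA) (p⊆q⇒∣p∣≤∣q∣ T∩J⊆⊥) ⟩
      ∣ N (V G) A ∣ + ∣ ⊥ {n} ∣  ≡⟨ cong (∣ N (V G) A ∣ +_) (∣⊥∣≡0 n) ⟩
      ∣ N (V G) A ∣ + 0          ≡⟨ ℕₚ.+-identityʳ _ ⟩
      ∣ N (V G) A ∣              <⟨ NA<A ⟩
      ∣ A ∣                      ≤⟨ p⊆q⇒∣p∣≤∣q∣ A⊆I∪J ⟩
      ∣ I ∪ J ∣                  ≤⟨ ∣p∪q∣≤∣p∣+∣q∣ I J ⟩
      ∣ I ∣ + ∣ J ∣              ∎)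
      where open ℕₚ.≤-Reasoning

-- Dominator's strategy

-- By finiteness, surjectivity makes `rotate` a permutation of `P`. It is the form needed, since the
-- strategy asks for predecessors.
record Rotation (G : Graph n) (P : Subset n) : Set where
  field
    rotate     : Fin n → Fin n
    ~rotate    : ∀ {v} → v ∈ P → Adj G v (rotate v)
    surjective : ∀ {v} → v ∈ P → ∃[ u ] (u ∈ P × rotate u ≡ v)

module DominatorStrategy {n} {G : Graph n} (rotation : Rotation G (V G)) where
  open Rotation rotation

  -- `followed` protects the future: if `i` is free, its predecessor cannot be Staller's, so it is
  -- available or already Dominator's.
  record Safe (D S : Subset n) : Set where
    field
      dominated : ∀ {s} → s ∈ S → ∃[ u ] (u ∈ D × Adj G u s)
      followed  : ∀ {s} → s ∈ S → rotate s ∈ D ⊎ rotate s ∈ S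

  safe-claimˡ : ∀ {D S} v → Safe D S → Safe (D ∪ ⁅ v ⁆) S
  safe-claimˡ v safe = record
    { dominated = λ s∈ → let u , u∈ , u~s = dominated s∈ in u , x∈p⇒x∈p∪⁅y⁆ u∈ , u~s
    ; followed  = λ s∈ → [ inj₁ ∘ x∈p⇒x∈p∪⁅y⁆ , inj₂ ]′ (followed s∈)
    } where open Safe safe

  safe-claimʳ : ∀ {D S i u} → Safe D S → u ∈ D → Adj G u i → rotate i ∈ D ⊎ rotate i ∈ S →
                Safe D (S ∪ ⁅ i ⁆)
  safe-claimʳ {D} {S} {i} safe u∈ u~i fol = record { dominated = dominated′ ; followed = followed′ }
    where
    open Safe safe
    dominated′ : ∀ {s} → s ∈ S ∪ ⁅ i ⁆ → ∃[ u ] (u ∈ D × Adj G u s)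
    dominated′ s∈ with x∈p∪⁅y⁆⁻ s∈
    ... | inj₁ s∈S  = dominated s∈S
    ... | inj₂ refl = _ , u∈ , u~i
    followed′ : ∀ {s} → s ∈ S ∪ ⁅ i ⁆ → rotate s ∈ D ⊎ rotate s ∈ S ∪ ⁅ i ⁆
    followed′ s∈ with x∈p∪⁅y⁆⁻ s∈
    ... | inj₁ s∈S  = [ inj₁ , inj₂ ∘ x∈p⇒x∈p∪⁅y⁆ ]′ (followed s∈S)
    ... | inj₂ refl = [ inj₁ , inj₂ ∘ x∈p⇒x∈p∪⁅y⁆ ]′ fol

  data Status (D S : Subset n) (v : Fin n) : Set where
    dominator’s : v ∈ D → Status D S v
    staller’s   : v ∈ S → Status D S v
    free        : v ∉ D → v ∉ S → Status D S v

  status : ∀ D S v → Status D S v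
  status D S v with v ∈? D | v ∈? S
  ... | yes v∈D | _       = dominator’s v∈D
  ... | no _    | yes v∈S = staller’s v∈S
  ... | no v∉D  | no v∉S  = free v∉D v∉S

  unclaimed⊎dominating : ∀ {D S} → Safe D S → ∃ (Unclaimed G D S) ⊎ Dominating G D
  unclaimed⊎dominating {D} {S} safe
    with any? (λ v → (v ∈? V G) ×-dec ¬? (v ∈? D) ×-dec ¬? (v ∈? S))
  ... | yes found = inj₁ found
  ... | no  none  = inj₂ λ {v} v∈ → dominates v∈ (status D S v)
    where
    dominates : ∀ {v} → v ∈ V G → Status D S v → v ∈ D ⊎ ∃[ u ] (u ∈ D × Adj G u v)
    dominates v∈ (dominator’s v∈D) = inj₁ v∈D
    dominates v∈ (staller’s v∈S)   = inj₂ (Safe.dominated safe v∈S)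
    dominates v∈ (free v∉D v∉S)    = contradiction (_ , v∈ , v∉D , v∉S) none

  -- Only Staller's moves consume fuel. `D′` is `D` itself or `D` with Dominator's reply.
  fuel-staller : ∀ k {D S i} D′ → D ⊆ D′ → i ∉ D → i ∉ S → n ≤ suc k + ∣ D ∪ S ∣ →
                 n ≤ k + ∣ D′ ∪ (S ∪ ⁅ i ⁆) ∣
  fuel-staller k {D} {S} {i} D′ D⊆ i∉D i∉S n≤ =
    ≤-trans (n≤1+k+∣U∣⇒n≤k+∣U∪⁅x⁆∣ k n≤ ([ i∉D , i∉S ]′ ∘ x∈p∪q⁻ D S)) (ℕₚ.+-monoʳ-≤ k (p⊆q⇒∣p∣≤∣q∣ grow))
    where
    grow : (D ∪ S) ∪ ⁅ i ⁆ ⊆ D′ ∪ (S ∪ ⁅ i ⁆)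
    grow x∈ with x∈p∪⁅y⁆⁻ x∈
    ... | inj₂ refl = x∈p∪q⁺ (inj₂ y∈p∪⁅y⁆)
    ... | inj₁ x∈′  = x∈p∪q⁺ ([ inj₁ ∘ D⊆ , inj₂ ∘ x∈p⇒x∈p∪⁅y⁆ ]′ (x∈p∪q⁻ D S x∈′))

  fuel-dominator : ∀ k {D S : Subset n} v → n ≤ k + ∣ D ∪ S ∣ → n ≤ k + ∣ (D ∪ ⁅ v ⁆) ∪ S ∣
  fuel-dominator k {D} {S} v n≤ = ≤-trans n≤ (ℕₚ.+-monoʳ-≤ k (p⊆q⇒∣p∣≤∣q∣ {q = (D ∪ ⁅ v ⁆) ∪ S}
    λ x∈ → x∈p∪q⁺ ([ inj₁ ∘ x∈p⇒x∈p∪⁅y⁆ , inj₂ ]′ (x∈p∪q⁻ D S x∈))))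

  -- Extra vertices do not spoil safety, so Dominator takes any free vertex when no reply is urgent.
  -- Each call from `waiting` lowers `k`, which makes the mutual recursion terminate.
  moving  : ∀ k {D S} → Safe D S → n ≤ k + ∣ D ∪ S ∣ → DominatorWins G dominator D S
  waiting : ∀ k {D S} → Safe D S → n ≤ k + ∣ D ∪ S ∣ → DominatorWins G staller D S

  moving k {D} {S} safe n≤ with unclaimed⊎dominating safe
  ... | inj₂ dominating  = won dominating
  ... | inj₁ (v , v-free) = move v v-free (waiting k (safe-claimˡ v safe) (fuel-dominator k {D} {S} v n≤))

  waiting k safe n≤ with unclaimed⊎dominating safe
  ... | inj₂ dominating = won dominating
  waiting zero {D} {S} safe n≤ | inj₁ (v , _ , v∉D , v∉S) =
    contradiction (n≤∣U∣⇒x∈U n≤) ([ v∉D , v∉S ]′ ∘ x∈p∪q⁻ D S)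
  waiting (suc k) {D} {S} safe n≤ | inj₁ free-vertex = answer free-vertex reply
    where
    open Safe safe
    claim : ∀ {v i} → Unclaimed G D S i → v ∈ V G → v ∉ D → v ∉ S → v ≢ i → Adj G v i →
            rotate i ∈ D ∪ ⁅ v ⁆ ⊎ rotate i ∈ S →
            DominatorWins G dominator D (S ∪ ⁅ i ⁆)
    claim {v} {i} (_ , i∉D , i∉S) v∈ v∉D v∉S v≢i v~i fol =
      move v (v∈ , v∉D , [ v∉S , v≢i ]′ ∘ x∈p∪⁅y⁆⁻)
        (waiting k (safe-claimʳ (safe-claimˡ v safe) y∈p∪⁅y⁆ v~i fol)
                   (fuel-staller k (D ∪ ⁅ v ⁆) x∈p⇒x∈p∪⁅y⁆ i∉D i∉S n≤))

    continue : ∀ {u i} → Unclaimed G D S i → u ∈ D → Adj G u i → rotate i ∈ D ⊎ rotate i ∈ S →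
               DominatorWins G dominator D (S ∪ ⁅ i ⁆)
    continue (_ , i∉D , i∉S) u∈D u~i fol =
      moving k (safe-claimʳ safe u∈D u~i fol) (fuel-staller k D (λ x∈ → x∈) i∉D i∉S n≤)

    reply : ∀ i → Unclaimed G D S i → DominatorWins G dominator D (S ∪ ⁅ i ⁆)
    reply i i-free@(i∈ , i∉D , i∉S) with status D S (rotate i)
    ... | dominator’s ri∈D = continue i-free ri∈D (Adj-sym G (~rotate i∈)) (inj₁ ri∈D)
    ... | free ri∉D ri∉S   = claim i-free (Adj⇒∈ʳ G (~rotate i∈)) ri∉D ri∉S
      (≢-sym (Adj⇒≢ G (~rotate i∈))) (Adj-sym G (~rotate i∈)) (inj₁ y∈p∪⁅y⁆)
    -- The successor of `i` is lost, so its predecessor `p` has to dominate it.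
    ... | staller’s ri∈S with surjective i∈
    ... | p , p∈ , refl with status D S p
    ... | dominator’s p∈D = continue i-free p∈D (~rotate p∈) (inj₂ ri∈S)
    ... | free p∉D p∉S    = claim i-free p∈ p∉D p∉S (Adj⇒≢ G (~rotate p∈)) (~rotate p∈) (inj₂ ri∈S)
    ... | staller’s p∈S   = ⊥-elim ([ i∉D , i∉S ]′ (followed p∈S))

  outcome-𝓓 : Outcome-𝓓 G
  outcome-𝓓 = λ
    { dominator → moving n safe (ℕₚ.m≤m+n n _)
    ; staller   → waiting n safe (ℕₚ.m≤m+n n _) }
    where
    safe : Safe ⊥ ⊥
    safe = record { dominated = λ s∈ → contradiction s∈ ∉⊥ ; followed = λ s∈ → contradiction s∈ ∉⊥ }

-- From factors to permutations

toℕ-next : (i : Fin (suc n)) → toℕ (next i) ≡ suc (toℕ i) % suc n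
toℕ-next {n} i = toℕ-fromℕ< (m%n<n (suc (toℕ i)) (suc n))

toℕ-next-< : (i : Fin (suc n)) → suc (toℕ i) < suc n → toℕ (next i) ≡ suc (toℕ i)
toℕ-next-< i i<n = trans (toℕ-next i) (m<n⇒m%n≡m i<n)

toℕ-next-≡ : (i : Fin (suc n)) → suc (toℕ i) ≡ suc n → toℕ (next i) ≡ 0
toℕ-next-≡ {n} i eq = trans (toℕ-next i) (trans (cong (_% suc n) eq) (n%n≡0 (suc n)))

next-surjective : (j : Fin (suc n)) → ∃[ i ] next i ≡ j
next-surjective {n} zero = fromℕ n , toℕ-injective (toℕ-next-≡ (fromℕ n) (cong suc (toℕ-fromℕ n)))
next-surjective {suc n} (suc j) = inject₁ j , toℕ-injective (trans
  (toℕ-next-< (inject₁ j) (s≤s (subst (_< suc n) (sym (toℕ-inject₁ j)) (toℕ<n j))))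
  (cong suc (toℕ-inject₁ j)))

vertex-≡ : ∀ {p : Subset n} {a b : ∃[ v ] v ∈ p} → proj₁ a ≡ proj₁ b → a ≡ b
vertex-≡ {a = _ , x} {_ , y} refl = cong (_ ,_) ([]=-irrelevant x y)

-- The rotation is `next` pulled back along the isomorphism. With `X` abstract, `K 2` and the cycles
-- are treated together.
≅⇒rotation : (H : Graph n) (X : Graph (suc m)) → V X ≡ ⊤ → (∀ i → Adj X i (next i)) → H ≅ X →
             Rotation H (V H)
≅⇒rotation {n} {m} H X VX≡⊤ ~next H≅X = record
  { rotate = rotate ; ~rotate = ~rotate ; surjective = surjective }
  where
  open _≅_ H≅X
  open Inverse bijection

  vertex : Fin (suc m) → Vertex X
  vertex i = i , subst (i ∈_) (sym VX≡⊤) ∈⊤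

  rotateᵛ : Vertex H → Vertex H
  rotateᵛ v = from (vertex (next (proj₁ (to v))))

  rotate : Fin n → Fin n
  rotate v with v ∈? V H
  ... | yes v∈ = proj₁ (rotateᵛ (v , v∈))
  ... | no  _  = v

  rotate≡ : ∀ v → rotate (proj₁ v) ≡ proj₁ (rotateᵛ v)
  rotate≡ (v , v∈) with v ∈? V H
  ... | yes v∈′ = cong (λ v∈ → proj₁ (rotateᵛ (v , v∈))) ([]=-irrelevant v∈′ v∈)
  ... | no  v∉  = contradiction v∈ v∉

  ~rotateᵛ : ∀ v → Adj H (proj₁ v) (proj₁ (rotateᵛ v))
  ~rotateᵛ v = Equivalence.from (preserves v (rotateᵛ v))
    (subst (Adj X _) (sym (cong proj₁ (strictlyInverseˡ (vertex _)))) (~next (proj₁ (to v))))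

  ~rotate : ∀ {v} → v ∈ V H → Adj H v (rotate v)
  ~rotate v∈ = subst (Adj H _) (sym (rotate≡ (_ , v∈))) (~rotateᵛ (_ , v∈))

  surjective : ∀ {v} → v ∈ V H → ∃[ u ] (u ∈ V H × rotate u ≡ v)
  surjective {v} v∈ = let i , next-i = next-surjective (proj₁ (to (v , v∈)))
                          u = from (vertex i) in
    proj₁ u , proj₂ u , (begin
      rotate (proj₁ u)                              ≡⟨ rotate≡ u ⟩
      proj₁ (from (vertex (next (proj₁ (to u)))))   ≡⟨ cong (λ x → proj₁ (from (vertex (next (proj₁ x)))))
                                                            (strictlyInverseˡ (vertex i)) ⟩
      proj₁ (from (vertex (next i)))                ≡⟨ cong (proj₁ ∘ from) (vertex-≡ next-i) ⟩
      proj₁ (from (to (v , v∈)))                    ≡⟨ cong proj₁ (strictlyInverseʳ (v , v∈)) ⟩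
      v                                             ∎)
    where open ≡-Reasoning

-- Components as reachable sets, and gluing their rotations

Closed : Graph n → Subset n → Set
Closed F U = ∀ {u w} → u ∈ U → Adj F u w → w ∈ U

module _ {n} (F : Graph n) where

  closed-Star : ∀ {U u w} → Closed F U → Star (Adj F) u w → u ∈ U → w ∈ U
  closed-Star closed ε         u∈ = u∈
  closed-Star closed (x ◅ xs)  u∈ = closed-Star closed xs (closed u∈ x)

  closed-Star-induced : ∀ {U u w} → Closed F U → Star (Adj F) u w → u ∈ U → Star (Adj (induced F U)) u w
  closed-Star-induced closed ε        u∈ = ε
  closed-Star-induced closed (x ◅ xs) u∈ =
    (x , u∈ , closed u∈ x) ◅ closed-Star-induced closed xs (closed u∈ x)

  record ReachableFrom (v : Fin n) : Set where
    field
      vertices : Subset n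
      base     : v ∈ vertices
      closed   : Closed F vertices
      reach    : ∀ {u} → u ∈ vertices → Star (Adj F) u v

  -- As long as an edge leaves the set, its far end is added; when none does, the set is closed.
  reachable : ∀ v → ReachableFrom v
  reachable v = grow n ⁅ v ⁆ (ℕₚ.m≤m+n n _) (x∈⁅x⁆ v) λ u∈ → reach-v (x∈⁅y⁆⇒x≡y v u∈)
    where
    reach-v : ∀ {u} → u ≡ v → Star (Adj F) u v
    reach-v refl = ε

    grow : ∀ k U → n ≤ k + ∣ U ∣ → v ∈ U → (∀ {u} → u ∈ U → Star (Adj F) u v) → ReachableFrom v
    grow k U n≤ v∈ reach
      with any? (λ w → ¬? (w ∈? U) ×-dec any? (λ u → (u ∈? U) ×-dec Adj? F u w))
    grow k U n≤ v∈ reach | no none = record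
      { vertices = U ; base = v∈ ; reach = reach
      ; closed   = λ {u} {w} u∈ u~w → decidable-stable (w ∈? U) λ w∉ → none (w , w∉ , u , u∈ , u~w) }
    grow zero    U n≤ v∈ reach | yes (w , w∉ , _) = contradiction (n≤∣U∣⇒x∈U n≤) w∉
    grow (suc k) U n≤ v∈ reach | yes (w , w∉ , u , u∈ , u~w) =
      grow k (U ∪ ⁅ w ⁆) (n≤1+k+∣U∣⇒n≤k+∣U∪⁅x⁆∣ k n≤ w∉) (x∈p⇒x∈p∪⁅y⁆ v∈) reach′
      where
      reach′ : ∀ {x} → x ∈ U ∪ ⁅ w ⁆ → Star (Adj F) x v
      reach′ x∈ with x∈p∪⁅y⁆⁻ x∈
      ... | inj₁ x∈U  = reach x∈U
      ... | inj₂ refl = Adj-sym F u~w ◅ reach u∈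

  reachable⊆V : ∀ {v} (r : ReachableFrom v) → v ∈ V F → ReachableFrom.vertices r ⊆ V F
  reachable⊆V r v∈ {u} u∈ with ReachableFrom.reach r u∈
  ... | ε       = v∈
  ... | u~w ◅ _ = Graph.~⇒∈V F u~w

  -- Maximality holds because a connected `K` containing `U` cannot leave it: walks from `v` stay
  -- inside a closed set.
  closed-connected⇒component : ∀ {U} → U ⊆ V F → Closed F U → Connected (induced F U) →
                               Component F (induced F U)
  closed-connected⇒component {U} U⊆V closed conn@((v , v∈) , _) =
    induced-⊑ F U⊆V , conn , maximal
    where
    maximal : ∀ K → K ⊑ F → Connected K → induced F U ⊑ K → K ⊑ induced F U
    maximal K K⊑F@(_ , K⇒F) (_ , K-conn) (U⊆K , _) = ⊑-induced F K K⊑F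
      λ w∈ → closed-Star closed (Star.map K⇒F (K-conn (U⊆K v∈) w∈)) v∈

  reachable-component : ∀ {v} (r : ReachableFrom v) → v ∈ V F →
                        Component F (induced F (ReachableFrom.vertices r))
  reachable-component r v∈ = closed-connected⇒component (reachable⊆V r v∈) closed
    (connected-from (induced F vertices) base λ u∈ → closed-Star-induced closed (reach u∈) u∈)
    where open ReachableFrom r

  rotation-∪ : ∀ {P U} → (∀ {u} → u ∈ P → u ∉ U) → Rotation F P → Rotation F U → Rotation F (P ∪ U)
  rotation-∪ {P} {U} disjoint ρ σ = record
    { rotate = rotate ; ~rotate = ~rotate ; surjective = surjective }
    where
    module ρ = Rotation ρ
    module σ = Rotation σ

    rotate : Fin n → Fin n
    rotate v with v ∈? U
    ... | yes _ = σ.rotate v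
    ... | no  _ = ρ.rotate v

    ~rotate : ∀ {v} → v ∈ P ∪ U → Adj F v (rotate v)
    ~rotate {v} v∈ with v ∈? U | x∈p∪q⁻ P U v∈
    ... | yes v∈U | _        = σ.~rotate v∈U
    ... | no _    | inj₁ v∈P = ρ.~rotate v∈P
    ... | no v∉U  | inj₂ v∈U = contradiction v∈U v∉U

    rotate-σ : ∀ {u} → u ∈ U → rotate u ≡ σ.rotate u
    rotate-σ {u} u∈U with u ∈? U
    ... | yes _  = refl
    ... | no u∉U = contradiction u∈U u∉U

    rotate-ρ : ∀ {u} → u ∉ U → rotate u ≡ ρ.rotate u
    rotate-ρ {u} u∉U with u ∈? U
    ... | yes u∈U = contradiction u∈U u∉U
    ... | no _    = refl

    surjective : ∀ {v} → v ∈ P ∪ U → ∃[ u ] (u ∈ P ∪ U × rotate u ≡ v)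
    surjective v∈ with x∈p∪q⁻ P U v∈
    ... | inj₁ v∈P = let u , u∈ , eq = ρ.surjective v∈P in
      u , x∈p∪q⁺ (inj₁ u∈) , trans (rotate-ρ (disjoint u∈)) eq
    ... | inj₂ v∈U = let u , u∈ , eq = σ.surjective v∈U in
      u , x∈p∪q⁺ (inj₂ u∈) , trans (rotate-σ u∈) eq

  -- Components are added one at a time to the part `P` already rotated. Keeping `P` closed makes
  -- each new component disjoint from it.
  rotation-from-components : (∀ H → Component F H → Rotation H (V H)) → Rotation F (V F)
  rotation-from-components rotation-of =
    assemble n ⊥ (λ u∈ → contradiction u∈ ∉⊥) (λ u∈ → contradiction u∈ ∉⊥)
      (record { rotate     = λ v → v
              ; ~rotate    = λ v∈ → contradiction v∈ ∉⊥
              ; surjective = λ v∈ → contradiction v∈ ∉⊥ })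
      (ℕₚ.m≤m+n n _)
    where
    assemble : ∀ k P → P ⊆ V F → Closed F P → Rotation F P → n ≤ k + ∣ P ∣ → Rotation F (V F)
    assemble k P P⊆V P-closed ρ n≤ with ⊆-or-∉ (V F) P
    assemble k P P⊆V P-closed ρ n≤ | inj₁ V⊆P = subst (Rotation F) (⊆-antisym P⊆V V⊆P) ρ
    assemble zero P P⊆V P-closed ρ n≤ | inj₂ (v , v∈ , v∉P) = contradiction (n≤∣U∣⇒x∈U n≤) v∉P
    assemble (suc k) P P⊆V P-closed ρ n≤ | inj₂ (v , v∈ , v∉P) =
      assemble k (P ∪ U) ([ P⊆V , reachable⊆V r v∈ ]′ ∘ x∈p∪q⁻ P U) closed′
        (rotation-∪ disjoint ρ σ)
        (≤-trans (n≤1+k+∣U∣⇒n≤k+∣U∪⁅x⁆∣ k n≤ v∉P) (ℕₚ.+-monoʳ-≤ k (p⊆q⇒∣p∣≤∣q∣ {p = P ∪ ⁅ v ⁆} grow)))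
      where
      r : ReachableFrom v
      r = reachable v
      open ReachableFrom r renaming (vertices to U)

      disjoint : ∀ {u} → u ∈ P → u ∉ U
      disjoint u∈P u∈U = v∉P (closed-Star P-closed (reach u∈U) u∈P)

      grow : P ∪ ⁅ v ⁆ ⊆ P ∪ U
      grow x∈ with x∈p∪⁅y⁆⁻ x∈
      ... | inj₁ x∈P  = x∈p∪q⁺ (inj₁ x∈P)
      ... | inj₂ refl = x∈p∪q⁺ (inj₂ base)

      closed′ : Closed F (P ∪ U)
      closed′ u∈ u~w with x∈p∪q⁻ P U u∈
      ... | inj₁ u∈P = x∈p∪q⁺ (inj₁ (P-closed u∈P u~w))
      ... | inj₂ u∈U = x∈p∪q⁺ (inj₂ (closed u∈U u~w))

      σ : Rotation F U
      σ = record { rotate = rotate ; ~rotate = proj₁ ∘ ~rotate ; surjective = surjective }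
        where open Rotation (rotation-of (induced F U) (reachable-component r v∈))

factor⇒rotation : {G : Graph n} → HasPerfect[1,2]-Factor G → Rotation G (V G)
factor⇒rotation {G = G} (F , (_ , F⇒G) , VF≡VG , components) =
  record { rotate = rotate ; ~rotate = F⇒G ∘ ~rotate ∘ to-VF
         ; surjective = λ v∈ → let u , u∈ , eq = surjective (to-VF v∈) in
                               u , subst (u ∈_) VF≡VG u∈ , eq }
  where
  to-VF : ∀ {v} → v ∈ V G → v ∈ V F
  to-VF {v} = subst (v ∈_) (sym VF≡VG)

  rotation-of : ∀ H → Component F H → Rotation H (V H)
  rotation-of H c with components H c
  ... | inj₁ H≅K₂      = ≅⇒rotation H (K 2) refl next-≢ H≅K₂
  ... | inj₂ (k , H≅C) = ≅⇒rotation H C[3+ k ] refl (λ _ → inj₁ refl) H≅C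

  open Rotation (rotation-from-components F rotation-of)

-- From permutations to factors

least : {P : ℕ → Set} → Decidable P → ∀ m → P m → ∃[ k ] (P k × (∀ {j} → j < k → ¬ P j))
least {P} P? m pm with P? 0
... | yes p0 = 0 , p0 , λ ()
least {P} P? zero    pm | no ¬p0 = contradiction pm ¬p0
least {P} P? (suc m) pm | no ¬p0 =
  let k , pk , below = least (P? ∘ suc) m pm in
  suc k , pk , λ { {zero} _ → ¬p0 ; {suc j} j<k → below (s≤s⁻¹ j<k) }

Consecutive : Fin (suc m) → Fin (suc m) → Set
Consecutive i j = j ≡ next i ⊎ i ≡ next j

module MatchingFactor {n} (G : Graph n) (matching : Hall.Matching (Adj? G) (V G) (V G)) where
  open Hall.Matching matching

  -- An edge of the factor may be traversed along `mate` or against it. On an orbit of length two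
  -- both directions give the same edge.
  Step : Fin n → Fin n → Set
  Step u v = v ≡ mate u ⊎ u ≡ mate v

  F : Graph n
  F = record
    { V        = V G
    ; _~_      = λ u v → u ∈ V G × v ∈ V G × Step u v
    ; _~?_     = λ u v → (u ∈? V G) ×-dec (v ∈? V G) ×-dec ((v ≟ mate u) ⊎-dec (u ≟ mate v))
    ; ~-sym    = λ (u∈ , v∈ , s) → v∈ , u∈ , swap s
    ; ~-irrefl = λ { refl (u∈ , _ , inj₁ eq) → mate≢ u∈ (sym eq)
                   ; refl (u∈ , _ , inj₂ eq) → mate≢ u∈ (sym eq) }
    ; ~⇒∈V     = proj₁
    }
    where
    mate≢ : ∀ {u} → u ∈ V G → mate u ≢ u
    mate≢ u∈ = ≢-sym (Adj⇒≢ G (~mate u∈))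

  F⊑G : F ⊑ G
  F⊑G = (λ u∈ → u∈) , λ
    { (u∈ , _ , inj₁ refl) → ~mate u∈
    ; (_ , v∈ , inj₂ refl) → Adj-sym G (~mate v∈) }

  orbit : Fin n → ℕ → Fin n
  orbit v zero    = v
  orbit v (suc i) = mate (orbit v i)

  orbit∈ : ∀ {v} → v ∈ V G → ∀ i → orbit v i ∈ V G
  orbit∈ v∈ zero    = v∈
  orbit∈ v∈ (suc i) = mate∈ (orbit∈ v∈ i)

  orbit-cancel : ∀ {v} → v ∈ V G → ∀ i d → orbit v i ≡ orbit v (i + d) → v ≡ orbit v d
  orbit-cancel v∈ zero    d eq = eq
  orbit-cancel v∈ (suc i) d eq =
    orbit-cancel v∈ i d (injective (orbit∈ v∈ i) (orbit∈ v∈ (i + d)) eq)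

  -- Injectivity strips the common `i` steps from both sides, so a repetition anywhere yields a
  -- return to `v` itself.
  orbit-return : ∀ {v i j} → v ∈ V G → i < j → orbit v i ≡ orbit v j →
                 ∃[ d ] (suc d ≤ j × orbit v (suc d) ≡ v)
  orbit-return {v} {i} {j} v∈ i<j eq =
    let d , 1+i+d≡j = ℕₚ.m≤n⇒∃[o]m+o≡n i<j
        i+1+d≡j = trans (ℕₚ.+-suc i d) 1+i+d≡j in
    d , subst (suc d ≤_) i+1+d≡j (ℕₚ.m≤n+m (suc d) i) ,
    sym (orbit-cancel v∈ i (suc d) (trans eq (cong (orbit v) (sym i+1+d≡j))))

  period : ∀ {v} → v ∈ V G →
           ∃[ q ] (orbit v (2 + q) ≡ v × (∀ {d} → d < suc q → orbit v (suc d) ≢ v))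
  period {v} v∈ with pigeonhole (ℕₚ.n<1+n n) (orbit v ∘ toℕ)
  ... | i , j , i<j , eq with orbit-return v∈ i<j eq
  ... | d , _ , return with least (λ k → orbit v (suc k) ≟ v) d return
  -- A fixed point would be its own neighbour. Hence the period is at least two and has the form
  -- `2 + q`.
  ... | zero  , fixed , _     = contradiction (sym fixed) (Adj⇒≢ G (~mate v∈))
  ... | suc q , return′ , min = q , return′ , min

  module Period {v : Fin n} (v∈ : v ∈ V G) {q : ℕ} (returns : orbit v (2 + q) ≡ v)
                (minimal : ∀ {d} → d < suc q → orbit v (suc d) ≢ v) where

    c : Fin (2 + q) → Fin n
    c = orbit v ∘ toℕ

    c-distinct : ∀ {i j} → toℕ i < toℕ j → c i ≢ c j
    c-distinct {i} {j} i<j eq = let d , d<j , return = orbit-return v∈ i<j eq in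
      minimal (s≤s⁻¹ (≤-<-trans d<j (toℕ<n j))) return

    c-injective : ∀ {i j} → c i ≡ c j → i ≡ j
    c-injective {i} {j} eq with ℕₚ.<-cmp (toℕ i) (toℕ j)
    ... | tri< i<j _ _ = contradiction eq (c-distinct i<j)
    ... | tri≈ _ i≡j _ = toℕ-injective i≡j
    ... | tri> _ _ j<i = contradiction (sym eq) (c-distinct j<i)

    mate-c : ∀ i → mate (c i) ≡ c (next i)
    mate-c i with ℕₚ.m≤n⇒m<n∨m≡n (toℕ<n i)
    ... | inj₁ lt = cong (orbit v) (sym (toℕ-next-< i lt))
    ... | inj₂ eq = trans (cong (orbit v) eq)
                   (trans returns (cong (orbit v) (sym (toℕ-next-≡ i eq))))

    OnCycle : Fin n → Set
    OnCycle u = ∃[ i ] c i ≡ u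

    onCycle? : Decidable OnCycle
    onCycle? u = any? λ i → c i ≟ u

    onCycle-step : ∀ {u w} → OnCycle u → Adj F u w → OnCycle w
    onCycle-step (i , refl) (_ , _ , inj₁ refl)      = next i , sym (mate-c i)
    -- For a step against `mate`, the predecessor of `c i` on the cycle has the same image as `w`,
    -- so injectivity identifies them.
    onCycle-step (i , refl) (_ , w∈ , inj₂ ci≡mate-w) with next-surjective i
    ... | j , refl = j , injective (orbit∈ v∈ (toℕ j)) w∈ (trans (mate-c j) ci≡mate-w)

    onCycle-Star : ∀ {u w} → OnCycle u → Star (Adj F) u w → OnCycle w
    onCycle-Star u∈ ε        = u∈
    onCycle-Star u∈ (x ◅ xs) = onCycle-Star (onCycle-step u∈ x) xs

    onCycle-orbit : ∀ i → OnCycle (orbit v i)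
    onCycle-orbit zero    = zero , refl
    onCycle-orbit (suc i) with onCycle-orbit i
    ... | j , eq = next j , trans (sym (mate-c j)) (cong mate eq)

    O : Subset n
    O = subset onCycle?

    orbit∈O : ∀ i → orbit v i ∈ O
    orbit∈O i = ∈-subset⁺ onCycle? (onCycle-orbit i)

    O-connected : Connected (induced F O)
    O-connected = connected-from (induced F O) (orbit∈O 0) λ u∈ →
      let i , eq = ∈-subset⁻ onCycle? u∈ in subst (λ u → Star _ u v) eq (to-v (toℕ i))
      where
      to-v : ∀ i → Star (Adj (induced F O)) (orbit v i) v
      to-v zero    = ε
      to-v (suc i) =
        ((orbit∈ v∈ (suc i) , orbit∈ v∈ i , inj₂ refl) , orbit∈O (suc i) , orbit∈O i) ◅ to-v i

    module _ (H : Graph n) (component : Component F H) (v∈H : v ∈ V H) where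

      H⊑F : H ⊑ F
      H⊑F = proj₁ component

      H⊆O : V H ⊆ O
      H⊆O u∈ = ∈-subset⁺ onCycle? (onCycle-Star (onCycle-orbit 0)
        (Star.map (proj₂ H⊑F) (proj₂ (proj₁ (proj₂ component)) v∈H u∈)))

      -- The orbit is connected and contains the component `H`, so maximality of `H` gives the
      -- reverse inclusion, edges included.
      O⊑H : induced F O ⊑ H
      O⊑H = proj₂ (proj₂ component) (induced F O) (induced-⊑ F O⊆V) O-connected
        (⊑-induced F H H⊑F H⊆O)
        where
        O⊆V : O ⊆ V F
        O⊆V u∈ with ∈-subset⁻ onCycle? u∈
        ... | i , refl = orbit∈ v∈ (toℕ i)

      -- The isomorphism sends a vertex to its position in the orbit. `X` is abstract so that one
      -- proof covers period two and all longer periods.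
      H≅cycle : (X : Graph (2 + q)) → V X ≡ ⊤ → (∀ i j → Consecutive i j ⇔ Adj X i j) → H ≅ X
      H≅cycle X VX≡⊤ X-step = record
        { bijection = mk↔ₛ′ to from to∘from from∘to ; preserves = preserves }
        where
        index : Vertex H → Fin (2 + q)
        index (u , u∈) = proj₁ (∈-subset⁻ onCycle? (H⊆O u∈))

        c-index : ∀ u → c (index u) ≡ proj₁ u
        c-index (u , u∈) = proj₂ (∈-subset⁻ onCycle? (H⊆O u∈))

        to : Vertex H → Vertex X
        to u = index u , subst (index u ∈_) (sym VX≡⊤) ∈⊤

        from : Vertex X → Vertex H
        from (i , _) = c i , proj₁ O⊑H (orbit∈O (toℕ i))

        to∘from : ∀ i → to (from i) ≡ i
        to∘from i = vertex-≡ (c-injective (c-index (from i)))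

        from∘to : ∀ u → from (to u) ≡ u
        from∘to u = vertex-≡ (c-index u)

        step : ∀ u w → Adj H (proj₁ u) (proj₁ w) → Consecutive (index u) (index w)
        step u w u~w with proj₂ (proj₂ (proj₂ H⊑F u~w))
        ... | inj₁ w≡ = inj₁ (c-injective (begin
          c (index w)        ≡⟨ c-index w ⟩
          proj₁ w            ≡⟨ w≡ ⟩
          mate (proj₁ u)     ≡⟨ cong mate (c-index u) ⟨
          mate (c (index u)) ≡⟨ mate-c (index u) ⟩
          c (next (index u)) ∎))
          where open ≡-Reasoning
        ... | inj₂ u≡ = inj₂ (c-injective (begin
          c (index u)        ≡⟨ c-index u ⟩
          proj₁ u            ≡⟨ u≡ ⟩
          mate (proj₁ w)     ≡⟨ cong mate (c-index w) ⟨
          mate (c (index w)) ≡⟨ mate-c (index w) ⟩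
          c (next (index w)) ∎))
          where open ≡-Reasoning

        c-step : ∀ i j → Consecutive i j → Adj H (c i) (c j)
        c-step i j s = proj₂ O⊑H
          ((orbit∈ v∈ (toℕ i) , orbit∈ v∈ (toℕ j) , c-Step s) , orbit∈O (toℕ i) , orbit∈O (toℕ j))
          where
          c-Step : Consecutive i j → Step (c i) (c j)
          c-Step (inj₁ refl) = inj₁ (sym (mate-c i))
          c-Step (inj₂ refl) = inj₂ (sym (mate-c j))

        preserves : ∀ u w → Adj H (proj₁ u) (proj₁ w) ⇔ Adj X (index u) (index w)
        preserves u w = mk⇔
          (Equivalence.to (X-step _ _) ∘ step u w)
          (subst₂ (Adj H) (c-index u) (c-index w) ∘ c-step _ _ ∘ Equivalence.from (X-step _ _))

  components : ∀ H → Component F H → H ≅ K 2 ⊎ ∃[ k ] H ≅ C[3+ k ]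
  components H component@(H⊑F , ((v , v∈H) , _) , _) with period (proj₁ H⊑F v∈H)
  ... | q , returns , minimal =
    by-period q (Period.H≅cycle (proj₁ H⊑F v∈H) returns minimal H component v∈H)
    where
    -- On two indices `next` is the swap, so consecutive and distinct mean the same.
    K₂-step : ∀ i j → Consecutive i j ⇔ Adj (K 2) i j
    K₂-step i j = mk⇔
      (λ { (inj₁ refl) → next-≢ i ; (inj₂ refl) → ≢-sym (next-≢ j) })
      (≢⇒step i j)
      where
      ≢⇒step : ∀ i j → i ≢ j → Consecutive i j
      ≢⇒step zero       zero       i≢j = contradiction refl i≢j
      ≢⇒step zero       (suc zero) _   = inj₁ refl
      ≢⇒step (suc zero) zero       _   = inj₁ refl
      ≢⇒step (suc zero) (suc zero) i≢j = contradiction refl i≢j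

    by-period : ∀ q → ((X : Graph (2 + q)) → V X ≡ ⊤ → (∀ i j → Consecutive i j ⇔ Adj X i j) → H ≅ X) →
                H ≅ K 2 ⊎ ∃[ k ] H ≅ C[3+ k ]
    by-period zero    iso = inj₁ (iso (K 2) refl K₂-step)
    by-period (suc k) iso = inj₂ (k , iso C[3+ k ] refl λ _ _ → mk⇔ (λ s → s) (λ s → s))

  factor : HasPerfect[1,2]-Factor G
  factor = F , F⊑G , refl , components

theorem3p8 : ∀ (n : ℕ) (G : Graph n) → IsBlockGraph G → Outcome-𝓓 G ⇔ HasPerfect[1,2]-Factor G
theorem3p8 n G block = mk⇔ outcome⇒factor (DominatorStrategy.outcome-𝓓 ∘ factor⇒rotation)
  where
  outcome⇒factor : Outcome-𝓓 G → HasPerfect[1,2]-Factor G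
  outcome⇒factor outcome with Hall.matching⊎deficient (Adj? G) n (V G) (V G) (∣p∣≤n (V G))
  ... | inj₁ matching       = MatchingFactor.factor G matching
  ... | inj₂ (_ , deficient) =
    contradiction (outcome staller) (StallerStrategy.deficient⇒staller-wins G block deficient)
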